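{- Let $r>3$ and $m\ge 2$ be integers and let $a,b,c,d$ be nonnegative integers, not all zero. Let $F=F(a,b,c,d)$ and $\alpha=\max\{a,d,\min\{b,c\}\}$, and suppose $(r-2)^{m-2}\ge 2\max\{a,b,c,d\}$. If $\alpha>0$, then \[\operatorname{forb}\big(m,r,F(a,b,c,d)\big)=m(r-1)^{m-1}+(r-1)^m+(\alpha-1)\binom{m}{2}.\] Otherwise (that is, $a=d=0$ and $\min\{b,c\}=0$), $F$ is the configuration $p\cdot\left[\begin{smallmatrix}0\\1\end{smallmatrix}\right]$ with $p=\max\{b,c\}$, and \[\operatorname{forb}\big(m,r,p\cdot\left[\begin{smallmatrix}0\\1\end{smallmatrix}\right]\big)=2(r-1)^m-(r-2)^m+(p-1)m(m-1).\]
   Context: For an integer $r\ge2$, an $r$-matrix is a matrix with entries in $\{0,1,\dots,r-1\}$; a $(0,1)$-matrix is a $2$-matrix. A matrix is simple if it has no repeated columns. For matrices $F$ and $A$, $F$ is a configuration of $A$, written $F\prec A$, if $A$ contains a submatrix that is a row and column permutation of $F$; otherwise $A$ avoids $F$. $\operatorname{forb}(m,r,F)$ is the maximum number of columns of a simple $m$-rowed $r$-matrix that avoids $F$. For a matrix $F$ and positive integer $p$, $p\cdot F$ denotes the matrix consisting of $p$ copies of $F$ placed side by side (each column repeated $p$ times). $F(a,b,c,d)$ is the $2$-rowed $(0,1)$-matrix with $a$ columns $\left[\begin{smallmatrix}0\\0\end{smallmatrix}\right]$, $b$ columns $\left[\begin{smallmatrix}1\\0\end{smallmatrix}\right]$,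 $c$ columns $\left[\begin{smallmatrix}0\\1\end{smallmatrix}\right]$ and $d$ columns $\left[\begin{smallmatrix}1\\1\end{smallmatrix}\right]$. -}

module Defs where

open import Data.Nat using (ℕ; zero; suc; _+_; _≤_)
open import Data.Fin using (Fin; toℕ)
open import Data.Vec using (Vec; replicate; _++_; lookup)
open import Data.Product using (Σ; _×_; ∃)
open import Relation.Nullary using (¬_)
open import Relation.Binary.PropositionalEquality using (_≡_)
open import Function.Definitions using (Injective)

RMatrix : ℕ → ℕ → ℕ → Set
RMatrix m n r = Fin m → Fin n → Fin r

NMatrix : ℕ → ℕ → Set
NMatrix k l = Fin k → Fin l → ℕ

Simple : ∀ {m n r} → RMatrix m n r → Set
Simple {m} {n} A = ∀ (j j' : Fin n) → (∀ (i : Fin m) → A i j ≡ A i j') → j ≡ j'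

-- F ≺ A: A has a submatrix that is a row and column permutation of F,
-- i.e. there are injective choices of rows σ and columns τ of A with
-- A (σ i) (τ j) = F i j.
_≺_ : ∀ {k l m n r} → NMatrix k l → RMatrix m n r → Set
_≺_ {k} {l} {m} {n} F A =
  Σ (Fin k → Fin m) λ σ → Σ (Fin l → Fin n) λ τ →
    Injective _≡_ _≡_ σ × Injective _≡_ _≡_ τ ×
    (∀ i j → toℕ (A (σ i) (τ j)) ≡ F i j)

IsForb : ∀ {k l} → ℕ → ℕ → NMatrix k l → ℕ → Set
IsForb m r F N =
  (Σ (RMatrix m N r) λ A → Simple A × ¬ (F ≺ A)) ×
  (∀ n (A : RMatrix m n r) → Simple A → ¬ (F ≺ A) → n ≤ N)

col : ℕ → ℕ → Fin 2 → ℕ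
col x y Fin.zero = x
col x y (Fin.suc _) = y

FCols : ∀ a b c d → Vec (Fin 2 → ℕ) (a + b + c + d)
FCols a b c d = ((replicate a (col 0 0) ++ replicate b (col 1 0))
             ++ replicate c (col 0 1)) ++ replicate d (col 1 1)

FMat : ∀ a b c d → NMatrix 2 (a + b + c + d)
FMat a b c d i j = lookup (FCols a b c d) j i

pCol : ∀ p → NMatrix 2 p
pCol p i j = col 0 1 i

{-# OPTIONS --safe #-}
module Submission where

-- If a matrix avoids F(a,b,c,d), then on every pair of rows one of the patterns 00, 11, 10, 01 occurs
-- fewer than α times, or 01 and 10 both occur fewer than max(b,c) times. Upper bound: delete these
-- few columns for every pair. Among the remaining ones let g₀ and g₁ be the columns below a 0 and
-- below a 1 in the first row. Then |g₀| + |g₁| = |g₀ ∪ g₁| + |g₀ ∩ g₁|; the union satisfies the same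
-- constraints on the other rows, and each row of the intersection misses 0 or 1. This gives
-- f(m) ≤ (r-1) f(m-1) + (r-1)^(m-1), hence m(r-1)^(m-1) + (r-1)^m; each pair on which both 01 and 10
-- are deleted lowers the bound by (r-2)^(m-2), which pays for its larger number of deleted columns.
-- Lower bound: take all columns without the pattern (x,y) on any i < j, where (x,y) is (0,0), (1,1) or
-- (0,1) according to which of a, d, min(b,c) is α, and add for every pair α - 1 columns with
-- entries x, y on that pair and entries at least 2 elsewhere. For α = 0 the patterns 01 and 10 are
-- both excluded, and what remains are the columns without 0 or without 1.
--
-- Sets of columns are encoded as weights Vec (Fin r) m → ℕ with values at most 1, and R is r - 2.

open import Defs
open import Algebra.Properties.Semiring.Sum as Sum using ()
open import Data.Bool using (Bool; true; false)
open import Data.Fin as F using (Fin; zero; suc; toℕ; _↑ˡ_; _↑ʳ_; splitAt)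
import Data.Fin.Properties as FP
open import Data.Nat using (ℕ; zero; suc; _+_; _*_; _∸_; _^_; _≤_; _<_; _⊔_; _⊓_; z≤n; s≤s; _<?_; _≟_)
open import Data.Nat.Properties
open import Data.Nat.Combinatorics using (_C_; nC1≡n; nCk+nC[k+1]≡[n+1]C[k+1])
open import Data.Nat.Tactic.RingSolver using (solve-∀)
open import Data.Product using (Σ; _×_; _,_; proj₁; proj₂; ∃; ∃₂)
open import Data.Sum using (_⊎_; inj₁; inj₂; [_,_]′)
open import Data.Vec using (Vec; []; _∷_; lookup; tabulate; replicate; _++_)
open import Data.Vec.Properties using (lookup∘tabulate; lookup-++ˡ; lookup-++ʳ; lookup-replicate; ∷-injective; tabulate∘lookup; tabulate-cong)
open import Function using (_∘_; id; const)
open import Function.Definitions using (Injective)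
open import Relation.Binary.Definitions using (tri<; tri≈; tri>)
open import Relation.Nullary using (¬_; yes; no; contradiction)
open import Relation.Binary.PropositionalEquality

open Sum +-*-semiring using (sum; sum-cong-≗; ∑-distrib-+; *-distribˡ-sum)

private variable
  m n r R : ℕ

-- Finite sums and sums over pairs of rows.

sum-mono : {f g : Fin n → ℕ} → (∀ k → f k ≤ g k) → sum f ≤ sum g
sum-mono {zero} f≤g = z≤n
sum-mono {suc n} f≤g = +-mono-≤ (f≤g zero) (sum-mono (f≤g ∘ suc))

sum-const : ∀ n c → sum {n} (const c) ≡ n * c
sum-const zero c = refl
sum-const (suc n) c = cong (c +_) (sum-const n c)

sum-zero : {f : Fin n → ℕ} → (∀ k → f k ≡ 0) → sum f ≡ 0
sum-zero {n} f≡0 = trans (sum-cong-≗ f≡0) (trans (sum-const n 0) (*-zeroʳ n))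

term≤sum : (f : Fin n → ℕ) → ∀ k → f k ≤ sum f
term≤sum f zero = m≤m+n _ _
term≤sum f (suc k) = ≤-trans (term≤sum (f ∘ suc) k) (m≤n+m _ _)

sum-single : (f : Fin n → ℕ) → ∀ k → (∀ l → l ≢ k → f l ≡ 0) → sum f ≡ f k
sum-single f zero others =
  trans (cong (f zero +_) (sum-zero λ l → others (suc l) λ ())) (+-identityʳ _)
sum-single f (suc k) others =
  cong₂ _+_ (others zero λ ()) (sum-single (f ∘ suc) k λ l l≢k → others (suc l) (l≢k ∘ FP.suc-injective))

sum≢0 : (f : Fin n → ℕ) → sum f ≢ 0 → ∃ λ k → f k ≢ 0
sum≢0 {zero} f s≢0 = contradiction refl s≢0
sum≢0 {suc n} f s≢0 with f zero ≟ 0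
... | no f0≢0 = zero , f0≢0
... | yes f0≡0 with k , fk≢0 ← sum≢0 (f ∘ suc) (λ s≡0 → s≢0 (cong₂ _+_ f0≡0 s≡0)) = suc k , fk≢0

sum-shift-≤ : {f : Fin n → ℕ} {t y : ℕ} → (∀ k → f k + t ≤ y) → sum f + n * t ≤ n * y
sum-shift-≤ {n} {f} {t} {y} f+t≤y = begin
  sum f + n * t                  ≡⟨ cong (sum f +_) (sum-const n t) ⟨
  sum f + sum {n} (const t)      ≡⟨ ∑-distrib-+ f (const t) ⟨
  sum (λ k → f k + t)            ≤⟨ sum-mono f+t≤y ⟩
  sum {n} (const y)              ≡⟨ sum-const n y ⟩
  n * y                          ∎
  where open ≤-Reasoning

-- Sums over the pairs i < j; the values of s at i ≥ j are irrelevant.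
pairSum : ∀ m → (Fin m → Fin m → ℕ) → ℕ
pairSum zero s = 0
pairSum (suc m) s = sum (λ j → s zero (suc j)) + pairSum m (λ i j → s (suc i) (suc j))

pairSum-mono : ∀ m {s t : Fin m → Fin m → ℕ} → (∀ i j → i F.< j → s i j ≤ t i j) → pairSum m s ≤ pairSum m t
pairSum-mono zero s≤t = z≤n
pairSum-mono (suc m) s≤t =
  +-mono-≤ (sum-mono λ j → s≤t zero (suc j) (s≤s z≤n)) (pairSum-mono m λ i j i<j → s≤t (suc i) (suc j) (s≤s i<j))

pairSum-zero : ∀ m {s : Fin m → Fin m → ℕ} → (∀ i j → i F.< j → s i j ≡ 0) → pairSum m s ≡ 0
pairSum-zero zero s≡0 = refl
pairSum-zero (suc m) s≡0 =
  cong₂ _+_ (sum-zero λ j → s≡0 zero (suc j) (s≤s z≤n)) (pairSum-zero m λ i j i<j → s≡0 (suc i) (suc j) (s≤s i<j))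

term≤pairSum : ∀ m (s : Fin m → Fin m → ℕ) i j → i F.< j → s i j ≤ pairSum m s
term≤pairSum (suc m) s zero (suc j) _ = ≤-trans (term≤sum (s zero ∘ suc) j) (m≤m+n _ _)
term≤pairSum (suc m) s (suc i) (suc j) (s≤s i<j) =
  ≤-trans (term≤pairSum m (λ i j → s (suc i) (suc j)) i j i<j) (m≤n+m _ _)

pairSum-single : ∀ m (s : Fin m → Fin m → ℕ) i j → i F.< j →
  (∀ k l → k F.< l → ¬ (k ≡ i × l ≡ j) → s k l ≡ 0) → pairSum m s ≡ s i j
pairSum-single (suc m) s zero (suc j) _ others = trans (cong₂ _+_
  (sum-single (s zero ∘ suc) j λ l l≢j → others zero (suc l) (s≤s z≤n) (l≢j ∘ FP.suc-injective ∘ proj₂))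
  (pairSum-zero m λ k l k<l → others (suc k) (suc l) (s≤s k<l) λ ())) (+-identityʳ _)
pairSum-single (suc m) s (suc i) (suc j) (s≤s i<j) others = cong₂ _+_
  (sum-zero λ l → others zero (suc l) (s≤s z≤n) λ ())
  (pairSum-single m (λ i j → s (suc i) (suc j)) i j i<j λ k l k<l kl≢ij →
    others (suc k) (suc l) (s≤s k<l) λ (p , q) → kl≢ij (FP.suc-injective p , FP.suc-injective q))

pairSum≢0 : ∀ m (s : Fin m → Fin m → ℕ) → pairSum m s ≢ 0 → ∃₂ λ i j → i F.< j × s i j ≢ 0
pairSum≢0 zero s p≢0 = contradiction refl p≢0
pairSum≢0 (suc m) s p≢0 with sum (λ j → s zero (suc j)) ≟ 0
... | no h≢0 with j , sj≢0 ← sum≢0 _ h≢0 = zero , suc j , s≤s z≤n , sj≢0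
... | yes h≡0 with i , j , i<j , s≢0 ← pairSum≢0 m (λ i j → s (suc i) (suc j)) (λ t≡0 → p≢0 (cong₂ _+_ h≡0 t≡0))
  = suc i , suc j , s≤s i<j , s≢0

interchange : ∀ a b c d → (a + b) + (c + d) ≡ (a + c) + (b + d)
interchange = solve-∀

pairSum-+ : ∀ m (s t : Fin m → Fin m → ℕ) → pairSum m (λ i j → s i j + t i j) ≡ pairSum m s + pairSum m t
pairSum-+ zero s t = refl
pairSum-+ (suc m) s t =
  trans (cong₂ _+_ (∑-distrib-+ (s zero ∘ suc) (t zero ∘ suc)) (pairSum-+ m _ _))
        (interchange (sum (s zero ∘ suc)) _ _ _)

pairSum-*ˡ : ∀ m c (s : Fin m → Fin m → ℕ) → pairSum m (λ i j → c * s i j) ≡ c * pairSum m s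
pairSum-*ˡ zero c s = sym (*-zeroʳ c)
pairSum-*ˡ (suc m) c s =
  trans (cong₂ _+_ (sym (*-distribˡ-sum c (s zero ∘ suc))) (pairSum-*ˡ m c _)) (sym (*-distribˡ-+ c _ _))

sucC2 : ∀ m → suc m C 2 ≡ m + m C 2
sucC2 m = trans (sym (nCk+nC[k+1]≡[n+1]C[k+1] m 1)) (cong (_+ m C 2) (nC1≡n m))

pairSum-const : ∀ m q → pairSum m (λ _ _ → q) ≡ q * (m C 2)
pairSum-const zero q = sym (*-zeroʳ q)
pairSum-const (suc m) q = begin
  sum {m} (const q) + pairSum m (λ _ _ → q)  ≡⟨ cong₂ _+_ (sum-const m q) (pairSum-const m q) ⟩
  m * q + q * (m C 2)                        ≡⟨ cong (_+ q * (m C 2)) (*-comm m q) ⟩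
  q * m + q * (m C 2)                        ≡⟨ *-distribˡ-+ q m (m C 2) ⟨
  q * (m + m C 2)                            ≡⟨ cong (q *_) (sucC2 m) ⟨
  q * (suc m C 2)                            ∎
  where open ≡-Reasoning

2*C2 : ∀ m → 2 * (m C 2) ≡ m * (m ∸ 1)
2*C2 zero = refl
2*C2 (suc m) = begin
  2 * (suc m C 2)      ≡⟨ cong (2 *_) (sucC2 m) ⟩
  2 * (m + m C 2)      ≡⟨ *-distribˡ-+ 2 m (m C 2) ⟩
  2 * m + 2 * (m C 2)  ≡⟨ cong (2 * m +_) (2*C2 m) ⟩
  2 * m + m * (m ∸ 1)  ≡⟨ lem m ⟩
  suc m * m            ∎
  where
  open ≡-Reasoning
  lem : ∀ m → 2 * m + m * (m ∸ 1) ≡ suc m * m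
  lem zero = refl
  lem (suc m) = alg m
    where
    alg : ∀ m → 2 * suc m + suc m * m ≡ suc (suc m) * suc m
    alg = solve-∀

2q*C2 : ∀ q m → 2 * q * (m C 2) ≡ q * (m * (m ∸ 1))
2q*C2 q m = trans (arrange q (m C 2)) (cong (q *_) (2*C2 m))
  where
  arrange : ∀ q c → 2 * q * c ≡ q * (2 * c)
  arrange = solve-∀

-- Total weight of a set of columns.

-- Recursion on the number of rows makes splitting off the first row a matter of computation.
count : (Vec (Fin r) m → ℕ) → ℕ
count {m = zero} w = w []
count {m = suc m} w = sum (λ x → count (λ v → w (x ∷ v)))

count-mono : {w w′ : Vec (Fin r) m → ℕ} → (∀ v → w v ≤ w′ v) → count w ≤ count w′
count-mono {m = zero} w≤w′ = w≤w′ []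
count-mono {m = suc m} w≤w′ = sum-mono λ x → count-mono λ v → w≤w′ (x ∷ v)

count-cong : {w w′ : Vec (Fin r) m → ℕ} → (∀ v → w v ≡ w′ v) → count w ≡ count w′
count-cong {m = zero} w≡w′ = w≡w′ []
count-cong {m = suc m} w≡w′ = sum-cong-≗ λ x → count-cong λ v → w≡w′ (x ∷ v)

count-+ : (w w′ : Vec (Fin r) m → ℕ) → count (λ v → w v + w′ v) ≡ count w + count w′
count-+ {m = zero} w w′ = refl
count-+ {m = suc m} w w′ = trans (sum-cong-≗ λ x → count-+ (w ∘ (x ∷_)) (w′ ∘ (x ∷_))) (∑-distrib-+ (λ x → count (w ∘ (x ∷_))) _)

count-*ˡ : ∀ c (w : Vec (Fin r) m → ℕ) → count (λ v → c * w v) ≡ c * count w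
count-*ˡ {m = zero} c w = refl
count-*ˡ {m = suc m} c w =
  trans (sum-cong-≗ λ x → count-*ˡ c (w ∘ (x ∷_))) (sym (*-distribˡ-sum c λ x → count (w ∘ (x ∷_))))

count-zero : {w : Vec (Fin r) m → ℕ} → (∀ v → w v ≡ 0) → count w ≡ 0
count-zero {m = zero} w≡0 = w≡0 []
count-zero {m = suc m} w≡0 = sum-zero λ x → count-zero λ v → w≡0 (x ∷ v)

count-sum : (w : Fin n → Vec (Fin r) m → ℕ) → count (λ v → sum (λ k → w k v)) ≡ sum (λ k → count (w k))
count-sum {n = zero} {m = m} w = count-zero {m = m} λ _ → refl
count-sum {n = suc n} w =
  trans (count-+ (w zero) (λ v → sum (λ k → w (suc k) v))) (cong (count (w zero) +_) (count-sum (w ∘ suc)))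

count-pairSum : ∀ n (w : Fin n → Fin n → Vec (Fin r) m → ℕ) →
  count (λ v → pairSum n (λ i j → w i j v)) ≡ pairSum n (λ i j → count (w i j))
count-pairSum {m = m} zero w = count-zero {m = m} λ _ → refl
count-pairSum (suc n) w = trans (count-+ (λ v → sum λ j → w zero (suc j) v) _)
  (cong₂ _+_ (count-sum (λ j → w zero (suc j))) (count-pairSum n λ i j → w (suc i) (suc j)))

-- Indicators with values in `ℕ`, so that conditions on entries can be multiplied, added and summed
-- over columns.
eq ne : Fin n → Fin n → ℕ
eq zero zero = 1
eq zero (suc _) = 0
eq (suc _) zero = 0
eq (suc x) (suc y) = eq x y
ne zero zero = 0
ne zero (suc _) = 1
ne (suc _) zero = 1
ne (suc x) (suc y) = ne x y

eq-refl : (x : Fin n) → eq x x ≡ 1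
eq-refl zero = refl
eq-refl (suc x) = eq-refl x

ne-refl : (x : Fin n) → ne x x ≡ 0
ne-refl zero = refl
ne-refl (suc x) = ne-refl x

eq≢0 : (x y : Fin n) → eq x y ≢ 0 → x ≡ y
eq≢0 zero zero _ = refl
eq≢0 zero (suc y) e≢0 = contradiction refl e≢0
eq≢0 (suc x) zero e≢0 = contradiction refl e≢0
eq≢0 (suc x) (suc y) e≢0 = cong suc (eq≢0 x y e≢0)

eq+ne : (x y : Fin n) → eq x y + ne x y ≡ 1
eq+ne zero zero = refl
eq+ne zero (suc y) = refl
eq+ne (suc x) zero = refl
eq+ne (suc x) (suc y) = eq+ne x y

eq≤1 : (x y : Fin n) → eq x y ≤ 1
eq≤1 x y = ≤-trans (m≤m+n _ _) (≤-reflexive (eq+ne x y))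

ne≤1 : (x y : Fin n) → ne x y ≤ 1
ne≤1 x y = ≤-trans (m≤n+m _ _) (≤-reflexive (eq+ne x y))

sum-eq-* : (x : Fin n) (f : Fin n → ℕ) → sum (λ y → eq x y * f y) ≡ f x
sum-eq-* x f = trans (sum-single _ x others) (trans (cong (_* f x) (eq-refl x)) (+-identityʳ _))
  where
  others : ∀ y → y ≢ x → eq x y * f y ≡ 0
  others y y≢x with eq x y ≟ 0
  ... | yes e≡0 = cong (_* f y) e≡0
  ... | no e≢0 = contradiction (sym (eq≢0 x y e≢0)) y≢x

sum-ne : (x : Fin (suc n)) → sum (ne x) ≡ n
sum-ne {n} zero = trans (sum-const n 1) (*-identityʳ n)
sum-ne {suc n} (suc x) = cong suc (sum-ne x)

sum-*ʳ : (f : Fin n → ℕ) (c : ℕ) → sum (λ k → f k * c) ≡ sum f * c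
sum-*ʳ f c = trans (sum-cong-≗ λ k → *-comm (f k) c) (trans (sym (*-distribˡ-sum c f)) (*-comm c (sum f)))

sum-eq : (x : Fin n) → sum (eq x) ≡ 1
sum-eq x = trans (sum-cong-≗ λ y → sym (*-identityʳ (eq x y))) (sum-eq-* x (const 1))

count-product : (f : Fin r → ℕ) (w : Vec (Fin r) m → ℕ) → sum (λ z → count (λ v → f z * w v)) ≡ sum f * count w
count-product f w = trans (sum-cong-≗ λ z → count-*ˡ (f z) w) (sum-*ʳ f (count w))

-- Families of columns as weights.

δ : Vec (Fin r) m → Vec (Fin r) m → ℕ
δ [] [] = 1
δ (x ∷ u) (y ∷ v) = eq x y * δ u v

δ≢0 : (u v : Vec (Fin r) m) → δ u v ≢ 0 → u ≡ v
δ≢0 [] [] _ = refl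
δ≢0 (x ∷ u) (y ∷ v) d≢0 = cong₂ _∷_
  (eq≢0 x y λ e≡0 → d≢0 (cong (_* δ u v) e≡0))
  (δ≢0 u v λ d≡0 → d≢0 (trans (cong (eq x y *_) d≡0) (*-zeroʳ (eq x y))))

δ≤1 : (u v : Vec (Fin r) m) → δ u v ≤ 1
δ≤1 [] [] = ≤-refl
δ≤1 (x ∷ u) (y ∷ v) = *-mono-≤ (eq≤1 x y) (δ≤1 u v)

count-δ : (u : Vec (Fin r) m) (h : Vec (Fin r) m → ℕ) → count (λ v → δ u v * h v) ≡ h u
count-δ [] h = +-identityʳ _
count-δ (x ∷ u) h = begin
  sum (λ y → count (λ v → eq x y * δ u v * h (y ∷ v)))
    ≡⟨ sum-cong-≗ (λ y → count-cong λ v → *-assoc (eq x y) (δ u v) _) ⟩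
  sum (λ y → count (λ v → eq x y * (δ u v * h (y ∷ v))))
    ≡⟨ sum-cong-≗ (λ y → trans (count-*ˡ (eq x y) (λ v → δ u v * h (y ∷ v))) (cong (eq x y *_) (count-δ u (h ∘ (y ∷_))))) ⟩
  sum (λ y → eq x y * h (y ∷ u))
    ≡⟨ sum-eq-* x (λ y → h (y ∷ u)) ⟩
  h (x ∷ u) ∎
  where open ≡-Reasoning

multiplicity : (Fin n → Vec (Fin r) m) → Vec (Fin r) m → ℕ
multiplicity u v = sum (λ k → δ (u k) v)

-- Double counting: this converts sums over the columns of a matrix into weighted counts over all
-- vectors.
count-multiplicity : (u : Fin n → Vec (Fin r) m) (h : Vec (Fin r) m → ℕ) →
  count (λ v → multiplicity u v * h v) ≡ sum (h ∘ u)
count-multiplicity u h = begin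
  count (λ v → multiplicity u v * h v)             ≡⟨ count-cong (λ v → sym (sum-*ʳ (λ k → δ (u k) v) (h v))) ⟩
  count (λ v → sum (λ k → δ (u k) v * h v))        ≡⟨ count-sum (λ k v → δ (u k) v * h v) ⟩
  sum (λ k → count (λ v → δ (u k) v * h v))        ≡⟨ sum-cong-≗ (λ k → count-δ (u k) h) ⟩
  sum (h ∘ u)                                      ∎
  where open ≡-Reasoning

multiplicity≢0 : (u : Fin n → Vec (Fin r) m) → ∀ v → multiplicity u v ≢ 0 → ∃ λ k → u k ≡ v
multiplicity≢0 u v m≢0 with k , d≢0 ← sum≢0 (λ k → δ (u k) v) m≢0 = k , δ≢0 (u k) v d≢0

multiplicity≤1 : {u : Fin n → Vec (Fin r) m} → Injective _≡_ _≡_ u → ∀ v → multiplicity u v ≤ 1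
multiplicity≤1 {u = u} inj v with multiplicity u v ≟ 0
... | yes m≡0 = ≤-trans (≤-reflexive m≡0) z≤n
... | no m≢0 with k , refl ← multiplicity≢0 u v m≢0 =
  ≤-trans (≤-reflexive (sum-single (λ k → δ (u k) (u _)) k others)) (δ≤1 (u k) (u k))
  where
  others : ∀ l → l ≢ k → δ (u l) (u k) ≡ 0
  others l l≢k with δ (u l) (u k) ≟ 0
  ... | yes d≡0 = d≡0
  ... | no d≢0 = contradiction (inj (δ≢0 (u l) (u k) d≢0)) l≢k

-- The multiplicity of an injective family is at most 1 and is supported where `h` is positive, so
-- it lies below `h` pointwise.
card≤count : {u : Fin n → Vec (Fin r) m} → Injective _≡_ _≡_ u → (h : Vec (Fin r) m → ℕ) →
  (∀ k → h (u k) ≢ 0) → n ≤ count h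
card≤count {n} {u = u} inj h h≢0 = begin
  n                                     ≡⟨ trans (sum-const n 1) (*-identityʳ n) ⟨
  sum {n} (const 1)                     ≡⟨ count-multiplicity u (const 1) ⟨
  count (λ v → multiplicity u v * 1)    ≤⟨ count-mono below ⟩
  count h                               ∎
  where
  open ≤-Reasoning
  below : ∀ v → multiplicity u v * 1 ≤ h v
  below v with multiplicity u v ≟ 0
  ... | yes m≡0 = ≤-trans (≤-reflexive (cong (_* 1) m≡0)) z≤n
  ... | no m≢0 with k , refl ← multiplicity≢0 u v m≢0 =
    ≤-trans (*-monoˡ-≤ 1 (multiplicity≤1 inj (u k))) (n≢0⇒n>0 (h≢0 k))

-- Choosing distinct columns from a weight.

-- The dependent pairs form a set of size `sum g`. The first `g zero ⊓ n` indices go to the block of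
-- `zero`, and the remaining `n ∸ g zero` are placed recursively.
sum-embed : (g : Fin r → ℕ) → n ≤ sum g →
  Σ (Fin n → Σ (Fin r) (Fin ∘ g)) (Injective _≡_ _≡_)
sum-embed {zero} g z≤n = (λ ()) , λ { {()} }
sum-embed {suc r} {n} g n≤ = f ∘ splitAt a ∘ F.cast (sym a+b≡n) , f-split-inj
  where
  a b : ℕ
  a = g zero ⊓ n
  b = n ∸ g zero
  a+b≡n : a + b ≡ n
  a+b≡n = m⊓n+n∸m≡n (g zero) n
  rec : Σ (Fin b → Σ (Fin r) (Fin ∘ g ∘ suc)) (Injective _≡_ _≡_)
  rec = sum-embed (g ∘ suc) (≤-trans (∸-monoˡ-≤ (g zero) n≤) (≤-reflexive (m+n∸m≡n (g zero) _)))
  f : Fin a ⊎ Fin b → Σ (Fin (suc r)) (Fin ∘ g)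
  f (inj₁ k) = zero , F.inject≤ k (m⊓n≤m (g zero) n)
  f (inj₂ k) = suc (proj₁ (proj₁ rec k)) , proj₂ (proj₁ rec k)
  shift : {p q : Σ (Fin r) (Fin ∘ g ∘ suc)} →
    _≡_ {A = Σ (Fin (suc r)) (Fin ∘ g)} (suc (proj₁ p) , proj₂ p) (suc (proj₁ q) , proj₂ q) → p ≡ q
  shift refl = refl
  head-inj : {x y : Fin (g zero)} → _≡_ {A = Σ (Fin (suc r)) (Fin ∘ g)} (zero , x) (zero , y) → x ≡ y
  head-inj refl = refl
  f-inj : ∀ s t → f s ≡ f t → s ≡ t
  f-inj (inj₁ k) (inj₁ l) e = cong inj₁ (FP.inject≤-injective _ _ k l (head-inj e))
  f-inj (inj₂ k) (inj₂ l) e = cong inj₂ (proj₂ rec (shift e))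
  f-inj (inj₁ _) (inj₂ _) ()
  f-inj (inj₂ _) (inj₁ _) ()
  f-split-inj : Injective _≡_ _≡_ (f ∘ splitAt a ∘ F.cast (sym a+b≡n))
  f-split-inj {x} {y} e = FP.toℕ-injective (begin
    toℕ x                         ≡⟨ FP.toℕ-cast (sym a+b≡n) x ⟨
    toℕ (F.cast (sym a+b≡n) x)    ≡⟨ cong toℕ (begin
      F.cast (sym a+b≡n) x                          ≡⟨ FP.join-splitAt a b _ ⟨
      F.join a b (splitAt a (F.cast _ x))           ≡⟨ cong (F.join a b) (f-inj _ _ e) ⟩
      F.join a b (splitAt a (F.cast _ y))           ≡⟨ FP.join-splitAt a b _ ⟩
      F.cast (sym a+b≡n) y                          ∎) ⟩
    toℕ (F.cast (sym a+b≡n) y)    ≡⟨ FP.toℕ-cast (sym a+b≡n) y ⟩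
    toℕ y                         ∎)
    where open ≡-Reasoning

-- The index in `Fin (count (w′ x))` that comes with a first entry `x` is decoded recursively into
-- the rest of the column and an index below its weight.
count-embed : (w : Vec (Fin r) m → ℕ) → n ≤ count w →
  Σ (Fin n → Σ (Vec (Fin r) m) (Fin ∘ w)) (Injective _≡_ _≡_)
count-embed {m = zero} w n≤ = (λ k → [] , F.inject≤ k n≤) , λ { {x} {y} e → FP.inject≤-injective n≤ n≤ x y (lem e) }
  where
  lem : {x y : Fin (w [])} → _≡_ {A = Σ (Vec (Fin _) 0) (Fin ∘ w)} ([] , x) ([] , y) → x ≡ y
  lem refl = refl
count-embed {r} {suc m} {n} w n≤ = (λ k → glue (proj₁ outer k)) , λ e → proj₂ outer (glue-inj _ _ e)
  where
  w′ : Fin r → Vec (Fin r) m → ℕ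
  w′ x v = w (x ∷ v)
  outer : Σ (Fin n → Σ (Fin r) (Fin ∘ count ∘ w′)) (Injective _≡_ _≡_)
  outer = sum-embed (count ∘ w′) n≤
  inner : ∀ x → Σ (Fin (count (w′ x)) → Σ (Vec (Fin r) m) (Fin ∘ w′ x)) (Injective _≡_ _≡_)
  inner x = count-embed (w′ x) ≤-refl
  glue : Σ (Fin r) (Fin ∘ count ∘ w′) → Σ (Vec (Fin r) (suc m)) (Fin ∘ w)
  glue (x , k) = x ∷ proj₁ (proj₁ (inner x) k) , proj₂ (proj₁ (inner x) k)
  tail-inj : ∀ {x} {p q : Σ (Vec (Fin r) m) (Fin ∘ w′ x)} →
    _≡_ {A = Σ (Vec (Fin r) (suc m)) (Fin ∘ w)} (x ∷ proj₁ p , proj₂ p) (x ∷ proj₁ q , proj₂ q) → p ≡ q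
  tail-inj refl = refl
  glue-inj : ∀ s t → glue s ≡ glue t → s ≡ t
  glue-inj (x , k) (y , l) e with proj₁ (∷-injective (cong proj₁ e))
  ... | refl = cong (x ,_) (proj₂ (inner x) (tail-inj e))

Fin≤1-unique : n ≤ 1 → (x y : Fin n) → x ≡ y
Fin≤1-unique (s≤s z≤n) zero zero = refl

Fin⇒≢0 : Fin n → n ≢ 0
Fin⇒≢0 () refl

-- When all values are at most 1, the second component of the embedding is determined by the first,
-- so projecting keeps injectivity.
sum-choose : (χ : Fin r → ℕ) → (∀ k → χ k ≤ 1) → n ≤ sum χ →
  ∃ λ (f : Fin n → Fin r) → Injective _≡_ _≡_ f × (∀ k → χ (f k) ≢ 0)
sum-choose χ χ≤1 n≤ with f , f-inj ← sum-embed χ n≤ = proj₁ ∘ f , (λ e → f-inj (lem _ _ e)) , λ k → Fin⇒≢0 (proj₂ (f k))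
  where
  lem : ∀ s t → proj₁ s ≡ proj₁ t → s ≡ t
  lem (k , x) (_ , y) refl = cong (k ,_) (Fin≤1-unique (χ≤1 k) x y)

count-choose : (w : Vec (Fin r) m → ℕ) → (∀ v → w v ≤ 1) → n ≤ count w →
  ∃ λ (f : Fin n → Vec (Fin r) m) → Injective _≡_ _≡_ f × (∀ k → w (f k) ≢ 0)
count-choose w w≤1 n≤ with f , f-inj ← count-embed w n≤ = proj₁ ∘ f , (λ e → f-inj (lem _ _ e)) , λ k → Fin⇒≢0 (proj₂ (f k))
  where
  lem : ∀ s t → proj₁ s ≡ proj₁ t → s ≡ t
  lem (k , x) (_ , y) refl = cong (k ,_) (Fin≤1-unique (w≤1 k) x y)

-- Forbidden patterns and the upper bound for columns that avoid them.

bit : Bool → Fin (2 + R)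
bit false = zero
bit true = suc zero

-- The patterns forbidden on a pair of rows i < j: a single (x,y), or both (0,1) and (1,0).
data Label : Set where
  single : Bool → Bool → Label
  both : Label

data Forbids {R} : Label → Fin (2 + R) → Fin (2 + R) → Set where
  pat : ∀ x y → Forbids (single x y) (bit x) (bit y)
  01b : Forbids both zero (suc zero)
  10b : Forbids both (suc zero) zero

-- The values of the second row that are forbidden when the first row may be both 0 and 1.
data Excludes {R} : Label → Fin (2 + R) → Set where
  snd : ∀ x y → Excludes (single x y) (bit y)
  0b : Excludes both zero
  1b : Excludes both (suc zero)

-- An excluded value completes a forbidden pattern below a 0 or below a 1. A column in the
-- intersection extends in both ways, so it cannot have that value.
excludes⇒forbids : ∀ {l} {z : Fin (2 + R)} → Excludes l z → Forbids l zero z ⊎ Forbids l (suc zero) z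
excludes⇒forbids (snd false y) = inj₁ (pat false y)
excludes⇒forbids (snd true y) = inj₂ (pat true y)
excludes⇒forbids 0b = inj₂ 10b
excludes⇒forbids 1b = inj₁ 01b

isBoth : Label → ℕ
isBoth (single _ _) = 0
isBoth both = 1

⊔+⊓ : ∀ m n → m ⊔ n + m ⊓ n ≡ m + n
⊔+⊓ zero n = +-identityʳ n
⊔+⊓ (suc m) zero = refl
⊔+⊓ (suc m) (suc n) = cong suc (trans (+-suc (m ⊔ n) (m ⊓ n)) (trans (cong suc (⊔+⊓ m n)) (sym (+-suc m n))))

-- Equality except at `m = 0`, where the exponent is truncated and `1 ≤ R` gives the inequality.
^-pred : 1 ≤ R → ∀ m → R ^ m ≤ R * R ^ (m ∸ 1)
^-pred {R} 1≤R zero = ≤-trans 1≤R (≤-reflexive (sym (*-identityʳ R)))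
^-pred 1≤R (suc m) = ≤-refl

*-swap : ∀ a b c → a * (b * c) ≡ b * (a * c)
*-swap = solve-∀

-- A single pattern leaves at most one of the two summands and asks for no saving; `both` leaves
-- neither, which makes room for `ρ`.
0or1-excluded : ∀ l (t : Fin (2 + R) → ℕ) {ρ y} → (∀ z → Excludes l z → t z ≡ 0) → (∀ z → t z ≤ y) → ρ ≤ y →
  t zero + t (suc zero) + isBoth l * ρ ≤ y
0or1-excluded (single x false) t ex t≤y ρ≤y
  rewrite ex zero (snd x false) | +-identityʳ (t (suc zero)) = t≤y (suc zero)
0or1-excluded (single x true) t ex t≤y ρ≤y
  rewrite ex (suc zero) (snd x true) | +-identityʳ (t zero) | +-identityʳ (t zero) = t≤y zero
0or1-excluded both t {ρ} ex t≤y ρ≤y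
  rewrite ex zero 0b | ex (suc zero) 1b | +-identityʳ ρ = ρ≤y

-- In each row the values 0 and 1 together contribute no more than one value would, whence the base
-- `suc R`. In a row labelled `both` neither occurs, and `R ^ (m ∸ 1)` is saved. This is the bound
-- for the intersection `g∩`.
count-excluding : 1 ≤ R → ∀ m (l : Fin m → Label) (h : Vec (Fin (2 + R)) m → ℕ) → (∀ v → h v ≤ 1) →
  (∀ v j → Excludes (l j) (lookup v j) → h v ≡ 0) →
  count h + sum (λ j → isBoth (l j) * R ^ (m ∸ 1)) ≤ suc R ^ m
count-excluding 1≤R zero l h h≤1 ex = ≤-trans (≤-reflexive (+-identityʳ _)) (h≤1 [])
count-excluding {R} 1≤R (suc m) l h h≤1 ex = begin
  t zero + (t (suc zero) + T) + (isBoth (l zero) * R ^ m + sum (λ j → isBoth (l (suc j)) * R ^ m))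
    ≤⟨ +-monoʳ-≤ (t zero + (t (suc zero) + T)) (+-monoʳ-≤ (isBoth (l zero) * R ^ m) scale) ⟩
  t zero + (t (suc zero) + T) + (isBoth (l zero) * R ^ m + R * S)
    ≡⟨ arrange (t zero) (t (suc zero)) T (isBoth (l zero) * R ^ m) (R * S) ⟩
  (t zero + t (suc zero) + isBoth (l zero) * R ^ m) + (T + R * S)
    -- The saving `S` of the later rows is dropped for the first entries 0 and 1 and kept for each
    -- of the `R` others.
    ≤⟨ +-mono-≤ (0or1-excluded (l zero) t t≡0 (λ z → m+n≤o⇒m≤o (t z) (ih z)) (^-monoˡ-≤ m (n≤1+n R)))
                (sum-shift-≤ (λ z → ih (suc (suc z)))) ⟩
  suc R ^ m + R * suc R ^ m ∎
  where
  open ≤-Reasoning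
  t : Fin (2 + R) → ℕ
  t z = count (λ v → h (z ∷ v))
  T S : ℕ
  T = sum (λ z → t (suc (suc z)))
  S = sum (λ j → isBoth (l (suc j)) * R ^ (m ∸ 1))
  ih : ∀ z → t z + S ≤ suc R ^ m
  ih z = count-excluding 1≤R m (l ∘ suc) (h ∘ (z ∷_)) (h≤1 ∘ (z ∷_)) λ v j → ex (z ∷ v) (suc j)
  t≡0 : ∀ z → Excludes (l zero) z → t z ≡ 0
  t≡0 z e = count-zero λ v → ex (z ∷ v) zero e
  scale : sum (λ j → isBoth (l (suc j)) * R ^ m) ≤ R * S
  scale = begin
    sum (λ j → isBoth (l (suc j)) * R ^ m)
      ≤⟨ sum-mono (λ j → ≤-trans (*-monoʳ-≤ (isBoth (l (suc j))) (^-pred 1≤R m)) (≤-reflexive (*-swap (isBoth (l (suc j))) R _))) ⟩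
    sum (λ j → R * (isBoth (l (suc j)) * R ^ (m ∸ 1)))
      ≡⟨ *-distribˡ-sum R (λ j → isBoth (l (suc j)) * R ^ (m ∸ 1)) ⟨
    R * S ∎
  arrange : ∀ a b c d e → a + (b + c) + (d + e) ≡ (a + b + d) + (c + e)
  arrange = solve-∀

mainTerm : ℕ → ℕ → ℕ
mainTerm R m = m * suc R ^ (m ∸ 1) + suc R ^ m

-- The grouping matches the union, the intersection and the `R` first entries at least 2. The case
-- `m = 0` is separate because `m ∸ 1` is truncated there.
mainTerm-suc : ∀ R m → mainTerm R (suc m) ≡ (mainTerm R m + suc R ^ m) + R * mainTerm R m
mainTerm-suc R zero = alg R
  where
  alg : ∀ R → (1 + 0) + suc R * 1 ≡ (0 + 1 + 1) + R * (0 + 1)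
  alg = solve-∀
mainTerm-suc R (suc m) = alg R m (suc R ^ m)
  where
  alg : ∀ R m p → suc (suc m) * (suc R * p) + suc R * (suc R * p) ≡
    (suc m * p + suc R * p + suc R * p) + R * (suc m * p + suc R * p)
  alg = solve-∀

-- Split on the first entry. The saving for pairs containing the first row comes from the
-- intersection; the saving for all other pairs comes from the induction hypothesis, once for each
-- of the `R` first entries at least 2.
count-forbidding : 1 ≤ R → ∀ m (L : Fin m → Fin m → Label) (g : Vec (Fin (2 + R)) m → ℕ) → (∀ v → g v ≤ 1) →
  (∀ v i j → i F.< j → Forbids (L i j) (lookup v i) (lookup v j) → g v ≡ 0) →
  count g + pairSum m (λ i j → isBoth (L i j) * R ^ (m ∸ 2)) ≤ mainTerm R m
count-forbidding 1≤R zero L g g≤1 forb = ≤-trans (≤-reflexive (+-identityʳ _)) (g≤1 [])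
count-forbidding {R} 1≤R (suc m) L g g≤1 forb = begin
  count g₀ + (count g₁ + T) + (S₀ + S)
    ≤⟨ +-monoʳ-≤ (count g₀ + (count g₁ + T)) (+-monoʳ-≤ S₀ scale) ⟩
  count g₀ + (count g₁ + T) + (S₀ + R * S′)
    ≡⟨ arrange₁ (count g₀) (count g₁) T S₀ (R * S′) ⟩
  (count g₀ + count g₁) + S₀ + (T + R * S′)
    ≡⟨ cong (λ t → t + S₀ + (T + R * S′)) ∪+∩ ⟩
  (count g∪ + count g∩) + S₀ + (T + R * S′)
    ≡⟨ cong (_+ (T + R * S′)) (+-assoc (count g∪) (count g∩) S₀) ⟩
  (count g∪ + (count g∩ + S₀)) + (T + R * S′)
    -- For the union the saving `S′` is discarded, since the copies kept for the `R` other first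
    -- entries already cover `S`.
    ≤⟨ +-mono-≤ (+-mono-≤ (m+n≤o⇒m≤o (count g∪) ih∪) bound∩) (sum-shift-≤ (λ z → ih (suc (suc z)))) ⟩
  (mainTerm R m + suc R ^ m) + R * mainTerm R m
    ≡⟨ mainTerm-suc R m ⟨
  mainTerm R (suc m) ∎
  where
  open ≤-Reasoning
  L′ : Fin m → Fin m → Label
  L′ i j = L (suc i) (suc j)
  g₀ g₁ g∪ g∩ : Vec (Fin (2 + R)) m → ℕ
  g₀ v = g (zero ∷ v)
  g₁ v = g (suc zero ∷ v)
  g∪ v = g₀ v ⊔ g₁ v
  g∩ v = g₀ v ⊓ g₁ v
  T S₀ S S′ : ℕ
  T = sum (λ z → count {m = m} (λ v → g (suc (suc z) ∷ v)))
  S₀ = sum (λ j → isBoth (L zero (suc j)) * R ^ (m ∸ 1))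
  S = pairSum m (λ i j → isBoth (L′ i j) * R ^ (m ∸ 1))
  S′ = pairSum m (λ i j → isBoth (L′ i j) * R ^ (m ∸ 2))
  ih : ∀ z → count (λ v → g (z ∷ v)) + S′ ≤ mainTerm R m
  ih z = count-forbidding 1≤R m L′ (g ∘ (z ∷_)) (g≤1 ∘ (z ∷_)) λ v i j i<j → forb (z ∷ v) (suc i) (suc j) (s≤s i<j)
  ih∪ : count g∪ + S′ ≤ mainTerm R m
  ih∪ = count-forbidding 1≤R m L′ g∪ (λ v → ⊔-lub (g≤1 (zero ∷ v)) (g≤1 (suc zero ∷ v))) λ v i j i<j f →
    cong₂ _⊔_ (forb (zero ∷ v) (suc i) (suc j) (s≤s i<j) f) (forb (suc zero ∷ v) (suc i) (suc j) (s≤s i<j) f)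
  excluded : ∀ v j → Excludes (L zero (suc j)) (lookup v j) → g∩ v ≡ 0
  excluded v j e with excludes⇒forbids e
  ... | inj₁ f = cong (_⊓ g₁ v) (forb (zero ∷ v) zero (suc j) (s≤s z≤n) f)
  ... | inj₂ f = trans (cong (g₀ v ⊓_) (forb (suc zero ∷ v) zero (suc j) (s≤s z≤n) f)) (⊓-zeroʳ (g₀ v))
  bound∩ : count g∩ + S₀ ≤ suc R ^ m
  bound∩ = count-excluding 1≤R m (λ j → L zero (suc j)) g∩ (λ v → ≤-trans (m⊓n≤m _ _) (g≤1 (zero ∷ v))) excluded
  ∪+∩ : count g₀ + count g₁ ≡ count g∪ + count g∩
  ∪+∩ = trans (sym (count-+ g₀ g₁)) (trans (count-cong λ v → sym (⊔+⊓ (g₀ v) (g₁ v))) (count-+ g∪ g∩))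
  scale : S ≤ R * S′
  scale = begin
    S ≤⟨ pairSum-mono m (λ i j _ → ≤-trans (*-monoʳ-≤ (isBoth (L′ i j)) (^-pred-∸ m)) (≤-reflexive (*-swap (isBoth (L′ i j)) R _))) ⟩
    pairSum m (λ i j → R * (isBoth (L′ i j) * R ^ (m ∸ 2))) ≡⟨ pairSum-*ˡ m R _ ⟩
    R * S′ ∎
    where
    ^-pred-∸ : ∀ m → R ^ (m ∸ 1) ≤ R * R ^ (m ∸ 2)
    ^-pred-∸ zero = ^-pred 1≤R 0
    ^-pred-∸ (suc m) = ^-pred 1≤R m
  arrange₁ : ∀ a b c d e → a + (b + c) + (d + e) ≡ (a + b) + d + (c + e)
  arrange₁ = solve-∀

-- Deleting the columns with forbidden patterns.

-- A numeric counterpart of `Forbids`, so that occurrences of forbidden patterns can be counted.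
forb : Label → Fin (2 + R) → Fin (2 + R) → ℕ
forb (single x y) u w = eq (bit x) u * eq (bit y) w
forb both u w = eq zero u * eq (suc zero) w + eq (suc zero) u * eq zero w

1≤forb : ∀ {l} {u w : Fin (2 + R)} → Forbids l u w → 1 ≤ forb l u w
1≤forb {R} (pat x y) rewrite eq-refl (bit {R} x) | eq-refl (bit {R} y) = ≤-refl
1≤forb 01b = ≤-refl
1≤forb 10b = ≤-refl

-- A union bound: subtracting from `P` the forbidden weight of every pair removes each bad column,
-- and the loss is at most the sum of the losses on the pairs.
count≤good+forbidden : ∀ (L : Fin m → Fin m → Label) (P : Vec (Fin (2 + R)) m → ℕ) → (∀ v → P v ≤ 1) →
  (bound : Fin m → Fin m → ℕ) →
  (∀ i j → i F.< j → count (λ v → P v * forb (L i j) (lookup v i) (lookup v j)) ≤ bound i j) →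
  ∃ λ g → (∀ v → g v ≤ 1) ×
    (∀ v i j → i F.< j → Forbids (L i j) (lookup v i) (lookup v j) → g v ≡ 0) ×
    count P ≤ count g + pairSum m bound
count≤good+forbidden {m} L P P≤1 bound few = g , (λ v → ≤-trans (m∸n≤m (P v) (b v)) (P≤1 v)) , g≡0 , (begin
  count P                                              ≤⟨ count-mono (λ v → m≤n+m∸n (P v) (b v)) ⟩
  count (λ v → b v + g v)                              ≡⟨ count-+ b g ⟩
  count b + count g                                    ≡⟨ +-comm (count b) (count g) ⟩
  count g + count b                                    ≡⟨ cong (count g +_) (count-pairSum m s) ⟩
  count g + pairSum m (λ i j → count (s i j))          ≤⟨ +-monoʳ-≤ (count g) (pairSum-mono m few) ⟩
  count g + pairSum m bound                            ∎)
  where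
  open ≤-Reasoning
  s : Fin m → Fin m → Vec (Fin (2 + _)) m → ℕ
  s i j v = P v * forb (L i j) (lookup v i) (lookup v j)
  b g : Vec (Fin (2 + _)) m → ℕ
  b v = pairSum m (λ i j → s i j v)
  -- A column may be bad on several pairs, so the subtraction can be truncated; only
  -- `P v ≤ b v + g v` is used for the count.
  g v = P v ∸ b v
  g≡0 : ∀ v i j → i F.< j → Forbids (L i j) (lookup v i) (lookup v j) → g v ≡ 0
  g≡0 v i j i<j f = m≤n⇒m∸n≡0 (begin
    P v        ≡⟨ *-identityʳ (P v) ⟨
    P v * 1    ≤⟨ *-monoʳ-≤ (P v) (1≤forb f) ⟩
    s i j v    ≤⟨ term≤pairSum m (λ i j → s i j v) i j i<j ⟩
    b v        ∎)

-- The extremal families without forbidden patterns.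

free : Fin r → Vec (Fin r) m → ℕ
free y [] = 1
free y (z ∷ v) = ne y z * free y v

free≤1 : (y : Fin r) (v : Vec (Fin r) m) → free y v ≤ 1
free≤1 y [] = ≤-refl
free≤1 y (z ∷ v) = *-mono-≤ (ne≤1 y z) (free≤1 y v)

count-free : ∀ m (y : Fin (suc r)) → count (free {m = m} y) ≡ r ^ m
count-free zero y = refl
count-free (suc m) y = trans (count-product (ne y) (free {m = m} y)) (cong₂ _*_ (sum-ne y) (count-free m y))

free-lookup : (v : Vec (Fin r) m) → ∀ i → free (lookup v i) v ≡ 0
free-lookup (z ∷ v) zero = cong (_* free z v) (ne-refl z)
free-lookup (z ∷ v) (suc i) = trans (cong (ne (lookup v i) z *_) (free-lookup v i)) (*-zeroʳ (ne (lookup v i) z))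

ne≡0 : (x y : Fin r) → ne x y ≡ 0 → x ≡ y
ne≡0 zero zero _ = refl
ne≡0 (suc x) (suc y) e = cong suc (ne≡0 x y e)

free≡0 : (y : Fin r) (v : Vec (Fin r) m) → free y v ≡ 0 → ∃ λ i → lookup v i ≡ y
free≡0 y (z ∷ v) f≡0 with m*n≡0⇒m≡0∨n≡0 (ne y z) f≡0
... | inj₁ n≡0 = zero , sym (ne≡0 y z n≡0)
... | inj₂ f′≡0 with i , e ← free≡0 y v f′≡0 = suc i , e

-- Columns without entries x and y at positions i < j.
ordered : Fin r → Fin r → Vec (Fin r) m → ℕ
ordered x y [] = 1
ordered x y (z ∷ v) = eq x z * free y v + ne x z * ordered x y v

-- Indicates the columns that lack 0 or lack 1: entries at least 2 are passed over until the first 0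
-- or 1, which decides the value that must not follow.
oneSided : Vec (Fin (2 + R)) m → ℕ
oneSided [] = 1
oneSided (zero ∷ v) = free (suc zero) v
oneSided (suc zero ∷ v) = free zero v
oneSided (suc (suc z) ∷ v) = oneSided v

ordered≤1 : (x y : Fin r) (v : Vec (Fin r) m) → ordered x y v ≤ 1
ordered≤1 x y [] = ≤-refl
ordered≤1 x y (z ∷ v) = begin
  eq x z * free y v + ne x z * ordered x y v
    ≤⟨ +-mono-≤ (*-monoʳ-≤ (eq x z) (free≤1 y v)) (*-monoʳ-≤ (ne x z) (ordered≤1 x y v)) ⟩
  eq x z * 1 + ne x z * 1   ≡⟨ cong₂ _+_ (*-identityʳ (eq x z)) (*-identityʳ (ne x z)) ⟩
  eq x z + ne x z           ≡⟨ eq+ne x z ⟩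
  1                         ∎
  where open ≤-Reasoning

ordered-lookup : (v : Vec (Fin r) m) → ∀ i j → i F.< j → ordered (lookup v i) (lookup v j) v ≡ 0
ordered-lookup (z ∷ v) zero (suc j) _
  rewrite free-lookup v j | ne-refl z | *-zeroʳ (eq z z) = refl
ordered-lookup (z ∷ v) (suc i) (suc j) (s≤s i<j)
  rewrite free-lookup v j | ordered-lookup v i j i<j | *-zeroʳ (eq (lookup v i) z) = *-zeroʳ (ne (lookup v i) z)

-- Below a first entry `x` the column must be free of `y`; below each of the `R + 1` other entries
-- the condition is the same again. This is the recurrence of `mainTerm`, whether or not `x` and `y`
-- coincide.
count-ordered : ∀ m (x y : Fin (2 + R)) → count (ordered {m = m} x y) ≡ mainTerm R m
count-ordered zero x y = refl
count-ordered {R} (suc m) x y = begin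
  sum (λ z → count {m = m} (λ v → eq x z * free y v + ne x z * ordered x y v))
    ≡⟨ sum-cong-≗ (λ z → count-+ (λ v → eq x z * free y v) (λ v → ne x z * ordered {m = m} x y v)) ⟩
  sum (λ z → count {m = m} (λ v → eq x z * free y v) + count {m = m} (λ v → ne x z * ordered x y v))
    ≡⟨ ∑-distrib-+ (λ z → count {m = m} (λ v → eq x z * free y v)) (λ z → count {m = m} (λ v → ne x z * ordered x y v)) ⟩
  sum (λ z → count {m = m} (λ v → eq x z * free y v)) + sum (λ z → count {m = m} (λ v → ne x z * ordered x y v))
    ≡⟨ cong₂ _+_ (count-product (eq x) (free {m = m} y)) (count-product (ne x) (ordered {m = m} x y)) ⟩
  sum (eq x) * F + sum (ne x) * G
    ≡⟨ cong₂ _+_ (trans (cong (_* F) (sum-eq x)) (+-identityʳ F)) (cong (_* G) (sum-ne x)) ⟩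
  F + suc R * G
    ≡⟨ cong₂ (λ f g → f + suc R * g) (count-free m y) (count-ordered m x y) ⟩
  suc R ^ m + suc R * mainTerm R m
    ≡⟨ arrange (suc R ^ m) (mainTerm R m) (R * mainTerm R m) ⟩
  mainTerm R m + suc R ^ m + R * mainTerm R m
    ≡⟨ mainTerm-suc R m ⟨
  mainTerm R (suc m) ∎
  where
  open ≡-Reasoning
  F G : ℕ
  F = count (free {m = m} y)
  G = count (ordered {m = m} x y)
  arrange : ∀ a b c → a + (b + c) ≡ b + a + c
  arrange = solve-∀

oneSided≤1 : (v : Vec (Fin (2 + R)) m) → oneSided v ≤ 1
oneSided≤1 [] = ≤-refl
oneSided≤1 (zero ∷ v) = free≤1 (suc zero) v
oneSided≤1 (suc zero ∷ v) = free≤1 zero v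
oneSided≤1 (suc (suc z) ∷ v) = oneSided≤1 v

oneSided-lookup : (v : Vec (Fin (2 + R)) m) → ∀ i j → i F.< j → Forbids both (lookup v i) (lookup v j) → oneSided v ≡ 0
oneSided-lookup (z ∷ v) zero (suc j) _ f = lem f refl refl
  where
  -- Matching on `Forbids` needs variables in place of the lookups, so the entries are generalised
  -- and tied back by equations.
  lem : ∀ {a b} → Forbids both a b → a ≡ z → b ≡ lookup v j → oneSided (z ∷ v) ≡ 0
  lem 01b refl b≡ = trans (cong (λ b → free b v) b≡) (free-lookup v j)
  lem 10b refl b≡ = trans (cong (λ b → free b v) b≡) (free-lookup v j)
oneSided-lookup (zero ∷ v) (suc i) (suc j) (s≤s i<j) f = lem f refl refl
  where
  lem : ∀ {a b} → Forbids both a b → a ≡ lookup v i → b ≡ lookup v j → oneSided (zero ∷ v) ≡ 0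
  lem 01b _ b≡ = trans (cong (λ b → free b v) b≡) (free-lookup v j)
  lem 10b a≡ _ = trans (cong (λ b → free b v) a≡) (free-lookup v i)
oneSided-lookup (suc zero ∷ v) (suc i) (suc j) (s≤s i<j) f = lem f refl refl
  where
  lem : ∀ {a b} → Forbids both a b → a ≡ lookup v i → b ≡ lookup v j → oneSided (suc zero ∷ v) ≡ 0
  lem 10b _ b≡ = trans (cong (λ b → free b v) b≡) (free-lookup v j)
  lem 01b a≡ _ = trans (cong (λ b → free b v) a≡) (free-lookup v i)
oneSided-lookup (suc (suc z) ∷ v) (suc i) (suc j) (s≤s i<j) f = oneSided-lookup v i j i<j f

oneSided≡0 : (v : Vec (Fin (2 + R)) m) → oneSided v ≡ 0 →
  ∃₂ λ i j → i F.< j × Forbids both (lookup v i) (lookup v j)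
oneSided≡0 (zero ∷ v) o≡0 with j , e ← free≡0 (suc zero) v o≡0 =
  zero , suc j , s≤s z≤n , subst (Forbids both zero) (sym e) 01b
oneSided≡0 (suc zero ∷ v) o≡0 with j , e ← free≡0 zero v o≡0 =
  zero , suc j , s≤s z≤n , subst (Forbids both (suc zero)) (sym e) 10b
oneSided≡0 (suc (suc z) ∷ v) o≡0 with i , j , i<j , f ← oneSided≡0 v o≡0 = suc i , suc j , s≤s i<j , f

-- Inclusion-exclusion over the columns without 0 and those without 1; `R ^ m` columns lack both.
-- The additive form keeps truncated subtraction out of the induction.
count-oneSided : ∀ R m → count (oneSided {R} {m}) + R ^ m ≡ 2 * suc R ^ m
count-oneSided R zero = refl
count-oneSided R (suc m) = begin
  count (free {m = m} (suc (zero {R}))) + (count (free {m = m} (zero {suc R})) + sum {R} (const c)) + R * R ^ m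
    ≡⟨ cong₂ (λ a b → a + (b + sum {R} (const c)) + R * R ^ m) (count-free m (suc zero)) (count-free m zero) ⟩
  q + (q + sum {R} (const c)) + R * R ^ m  ≡⟨ cong (λ s → q + (q + s) + R * R ^ m) (sum-const R c) ⟩
  q + (q + R * c) + R * R ^ m              ≡⟨ arrange q R c (R ^ m) ⟩
  2 * q + R * (c + R ^ m)                  ≡⟨ cong (λ s → 2 * q + R * s) (count-oneSided R m) ⟩
  2 * q + R * (2 * q)                      ≡⟨ arrange′ q R ⟩
  2 * (suc R * q)                          ∎
  where
  open ≡-Reasoning
  q c : ℕ
  q = suc R ^ m
  c = count (oneSided {R} {m})
  arrange : ∀ q R c p → q + (q + R * c) + R * p ≡ 2 * q + R * (c + p)
  arrange = solve-∀
  arrange′ : ∀ q R → 2 * q + R * (2 * q) ≡ 2 * (suc R * q)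
  arrange′ = solve-∀

-- `oneSided` dominates every such weight: wherever it vanishes, the column has a 0 and a 1, hence a
-- forbidden pair.
count-forbidding-both : ∀ m (g : Vec (Fin (2 + R)) m → ℕ) → (∀ v → g v ≤ 1) →
  (∀ v i j → i F.< j → Forbids both (lookup v i) (lookup v j) → g v ≡ 0) → count g ≤ 2 * suc R ^ m ∸ R ^ m
count-forbidding-both {R} m g g≤1 forb = begin
  count g                                        ≤⟨ count-mono below ⟩
  count (oneSided {R} {m})                       ≡⟨ m+n∸n≡m _ (R ^ m) ⟨
  count (oneSided {R} {m}) + R ^ m ∸ R ^ m       ≡⟨ cong (_∸ R ^ m) (count-oneSided R m) ⟩
  2 * suc R ^ m ∸ R ^ m                          ∎
  where
  open ≤-Reasoning
  below : ∀ v → g v ≤ oneSided v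
  below v with oneSided v ≟ 0
  ... | no o≢0 = ≤-trans (g≤1 v) (n≢0⇒n>0 o≢0)
  ... | yes o≡0 with i , j , i<j , f ← oneSided≡0 v o≡0 = ≤-trans (≤-reflexive (forb v i j i<j f)) z≤n

-- Reducing a weight to a prescribed total.

-- The summands are what a greedy choice with quota `q` takes from the first value and, with the
-- quota left over, from the rest.
sum-trim : ∀ q s₀ s → (s₀ ⊓ q) + (s ⊓ (q ∸ s₀)) ≡ (s₀ + s) ⊓ q
sum-trim q zero s = refl
sum-trim zero (suc s₀) s = ⊓-zeroʳ s
sum-trim (suc q) (suc s₀) s = cong suc (sum-trim q s₀ s)

trimSum : ℕ → (Fin n → ℕ) → Fin n → ℕ
trimSum q f zero = f zero ⊓ q
trimSum q f (suc k) = trimSum (q ∸ f zero) (f ∘ suc) k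

trimSum≤ : ∀ q (f : Fin n → ℕ) k → trimSum q f k ≤ f k
trimSum≤ q f zero = m⊓n≤m _ _
trimSum≤ q f (suc k) = trimSum≤ (q ∸ f zero) (f ∘ suc) k

sum-trimSum : ∀ q (f : Fin n → ℕ) → sum (trimSum q f) ≡ sum f ⊓ q
sum-trimSum {zero} q f = refl
sum-trimSum {suc n} q f =
  trans (cong (f zero ⊓ q +_) (sum-trimSum (q ∸ f zero) (f ∘ suc))) (sum-trim q (f zero) (sum (f ∘ suc)))

-- Greedily lowers w until its total is at most q.
trim : ℕ → (Vec (Fin r) m → ℕ) → Vec (Fin r) m → ℕ
trim q w [] = w [] ⊓ q
trim q w (x ∷ v) = trim (trimSum q (λ z → count (w ∘ (z ∷_))) x) (w ∘ (x ∷_)) v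

trim≤ : ∀ q (w : Vec (Fin r) m → ℕ) v → trim q w v ≤ w v
trim≤ q w [] = m⊓n≤m _ _
trim≤ q w (x ∷ v) = trim≤ _ (w ∘ (x ∷_)) v

-- The quota given to a first entry never exceeds the weight below it, so each recursive call fills
-- its quota exactly.
count-trim : ∀ q (w : Vec (Fin r) m → ℕ) → count (trim q w) ≡ count w ⊓ q
count-trim {m = zero} q w = refl
count-trim {m = suc m} q w = trans
  (sum-cong-≗ λ x → trans (count-trim (trimSum q c x) (w ∘ (x ∷_))) (m≥n⇒m⊓n≡n (trimSum≤ q c x)))
  (sum-trimSum q c)
  where
  c : Fin _ → ℕ
  c z = count (w ∘ (z ∷_))

-- Columns with a pattern on one pair and large entries elsewhere.

hi : Fin (2 + R) → ℕ
hi zero = 0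
hi (suc zero) = 0
hi (suc (suc _)) = 1

high : Vec (Fin (2 + R)) m → ℕ
high [] = 1
high (z ∷ v) = hi z * high v

high₁ : Fin m → Fin (2 + R) → Vec (Fin (2 + R)) m → ℕ
high₁ zero y (z ∷ v) = eq y z * high v
high₁ (suc j) y (z ∷ v) = hi z * high₁ j y v

-- Indicates, for i < j, the columns with entries x and y at i and j and all other entries at least 2.
high₂ : Fin m → Fin m → Fin (2 + R) → Fin (2 + R) → Vec (Fin (2 + R)) m → ℕ
high₂ _ zero x y v = 0
high₂ zero (suc j) x y (z ∷ v) = eq x z * high₁ j y v
high₂ (suc i) (suc j) x y (z ∷ v) = hi z * high₂ i j x y v

*≢0 : ∀ a b → a * b ≢ 0 → a ≢ 0 × b ≢ 0
*≢0 a b ab≢0 = (λ { refl → ab≢0 refl }) , (λ { refl → ab≢0 (*-zeroʳ a) })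

hi≤1 : (z : Fin (2 + R)) → hi z ≤ 1
hi≤1 zero = z≤n
hi≤1 (suc zero) = z≤n
hi≤1 (suc (suc _)) = ≤-refl

high≤1 : (v : Vec (Fin (2 + R)) m) → high v ≤ 1
high≤1 [] = ≤-refl
high≤1 (z ∷ v) = *-mono-≤ (hi≤1 z) (high≤1 v)

high₁≤1 : ∀ j y (v : Vec (Fin (2 + R)) m) → high₁ j y v ≤ 1
high₁≤1 zero y (z ∷ v) = *-mono-≤ (eq≤1 y z) (high≤1 v)
high₁≤1 (suc j) y (z ∷ v) = *-mono-≤ (hi≤1 z) (high₁≤1 j y v)

high₂≤1 : ∀ i j x y (v : Vec (Fin (2 + R)) m) → high₂ i j x y v ≤ 1
high₂≤1 _ zero x y v = z≤n
high₂≤1 zero (suc j) x y (z ∷ v) = *-mono-≤ (eq≤1 x z) (high₁≤1 j y v)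
high₂≤1 (suc i) (suc j) x y (z ∷ v) = *-mono-≤ (hi≤1 z) (high₂≤1 i j x y v)

high-lookup : (v : Vec (Fin (2 + R)) m) → high v ≢ 0 → ∀ k → hi (lookup v k) ≢ 0
high-lookup (z ∷ v) h≢0 zero = proj₁ (*≢0 (hi z) (high v) h≢0)
high-lookup (z ∷ v) h≢0 (suc k) = high-lookup v (proj₂ (*≢0 (hi z) (high v) h≢0)) k

high₁-lookup : ∀ j y (v : Vec (Fin (2 + R)) m) → high₁ j y v ≢ 0 →
  lookup v j ≡ y × (∀ k → k ≢ j → hi (lookup v k) ≢ 0)
high₁-lookup zero y (z ∷ v) h≢0 with e≢0 , t≢0 ← *≢0 (eq y z) (high v) h≢0 =
  sym (eq≢0 y z e≢0) , λ { zero k≢j → contradiction refl k≢j ; (suc k) _ → high-lookup v t≢0 k }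
high₁-lookup (suc j) y (z ∷ v) h≢0 with z≢0 , t≢0 ← *≢0 (hi z) (high₁ j y v) h≢0
  with vj , others ← high₁-lookup j y v t≢0 =
  vj , λ { zero _ → z≢0 ; (suc k) k≢j → others k (k≢j ∘ cong suc) }

high₂-lookup : ∀ i j x y (v : Vec (Fin (2 + R)) m) → high₂ i j x y v ≢ 0 →
  lookup v i ≡ x × lookup v j ≡ y × (∀ k → k ≢ i → k ≢ j → hi (lookup v k) ≢ 0)
high₂-lookup _ zero x y v h≢0 = contradiction refl h≢0
high₂-lookup zero (suc j) x y (z ∷ v) h≢0 with e≢0 , t≢0 ← *≢0 (eq x z) (high₁ j y v) h≢0
  with vj , others ← high₁-lookup j y v t≢0 =
  sym (eq≢0 x z e≢0) , vj , λ { zero k≢i _ → contradiction refl k≢i ; (suc k) _ k≢j → others k (k≢j ∘ cong suc) }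
high₂-lookup (suc i) (suc j) x y (z ∷ v) h≢0 with z≢0 , t≢0 ← *≢0 (hi z) (high₂ i j x y v) h≢0
  with vi , vj , others ← high₂-lookup i j x y v t≢0 =
  vi , vj , λ { zero _ _ → z≢0 ; (suc k) k≢i k≢j → others k (k≢i ∘ cong suc) (k≢j ∘ cong suc) }

sum-hi : ∀ R → sum (hi {R}) ≡ R
sum-hi R = trans (sum-const R 1) (*-identityʳ R)

count-hi : (w : Vec (Fin (2 + R)) m → ℕ) → sum (λ z → count (λ v → hi {R} z * w v)) ≡ R * count w
count-hi {R} w = trans (count-product (hi {R}) w) (cong (_* count w) (sum-hi R))

count-eq : (x : Fin r) (w : Vec (Fin r) m → ℕ) → sum (λ z → count (λ v → eq x z * w v)) ≡ count w
count-eq x w = trans (count-product (eq x) w) (trans (cong (_* count w) (sum-eq x)) (+-identityʳ (count w)))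

count-high : ∀ R m → count (high {R} {m}) ≡ R ^ m
count-high R zero = refl
count-high R (suc m) = trans (count-hi (high {R} {m})) (cong (R *_) (count-high R m))

count-high₁ : 1 ≤ R → ∀ j (y : Fin (2 + R)) → R ^ (m ∸ 1) ≤ count (high₁ {m} j y)
count-high₁ {R} {suc m} 1≤R zero y = ≤-reflexive (sym (trans (count-eq y (high {R} {m})) (count-high R m)))
count-high₁ {R} {suc m} 1≤R (suc j) y = begin
  R ^ m                            ≤⟨ ^-pred 1≤R m ⟩
  R * R ^ (m ∸ 1)                  ≤⟨ *-monoʳ-≤ R (count-high₁ 1≤R j y) ⟩
  R * count (high₁ j y)            ≡⟨ count-hi (high₁ j y) ⟨
  count (high₁ (suc j) y)          ∎
  where open ≤-Reasoning

count-high₂ : 1 ≤ R → ∀ i j (x y : Fin (2 + R)) → i F.< j → R ^ (m ∸ 2) ≤ count (high₂ {m} i j x y)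
count-high₂ {R} 1≤R zero (suc j) x y _ = ≤-trans (count-high₁ 1≤R j y) (≤-reflexive (sym (count-eq x (high₁ j y))))
count-high₂ {R} {suc (suc m)} 1≤R (suc i) (suc j) x y (s≤s i<j) = begin
  R ^ m                               ≤⟨ ^-pred 1≤R m ⟩
  R * R ^ (m ∸ 1)                     ≤⟨ *-monoʳ-≤ R (count-high₂ 1≤R i j x y i<j) ⟩
  R * count (high₂ i j x y)           ≡⟨ count-hi (high₂ i j x y) ⟨
  count (high₂ (suc i) (suc j) x y)   ∎
  where open ≤-Reasoning

-- The columns added for one pair: a quota of `q` for each forbidden pattern, hence `2q` under
-- `both`.
extra : ℕ → Label → Fin m → Fin m → Vec (Fin (2 + R)) m → ℕ
extra q (single x y) i j v = trim q (high₂ i j (bit x) (bit y)) v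
extra q both i j v = trim q (high₂ i j zero (suc zero)) v + trim q (high₂ i j (suc zero) zero) v

trim-lookup : ∀ q i j x y (v : Vec (Fin (2 + R)) m) → trim q (high₂ i j x y) v ≢ 0 →
  lookup v i ≡ x × lookup v j ≡ y × (∀ k → k ≢ i → k ≢ j → hi (lookup v k) ≢ 0)
trim-lookup q i j x y v t≢0 = high₂-lookup i j x y v
  λ h≡0 → t≢0 (n≤0⇒n≡0 (≤-trans (trim≤ q (high₂ i j x y) v) (≤-reflexive h≡0)))

trim≤1 : ∀ q i j x y (v : Vec (Fin (2 + R)) m) → trim q (high₂ i j x y) v ≤ 1
trim≤1 q i j x y v = ≤-trans (trim≤ q (high₂ i j x y) v) (high₂≤1 i j x y v)

trim-other : ∀ q i j x x′ y′ (v : Vec (Fin (2 + R)) m) → x ≢ x′ → lookup v i ≡ x → trim q (high₂ i j x′ y′) v ≡ 0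
trim-other q i j x x′ y′ v x≢x′ vi≡x with trim q (high₂ i j x′ y′) v ≟ 0
... | yes t≡0 = t≡0
... | no t≢0 = contradiction (trans (sym vi≡x) (proj₁ (trim-lookup q i j x′ y′ v t≢0))) x≢x′

extra-lookup : ∀ q l i j (v : Vec (Fin (2 + R)) m) → extra q l i j v ≢ 0 →
  Forbids l (lookup v i) (lookup v j) × (∀ k → k ≢ i → k ≢ j → hi (lookup v k) ≢ 0)
extra-lookup q (single x y) i j v e≢0 with vi , vj , others ← trim-lookup q i j (bit x) (bit y) v e≢0 =
  subst₂ (Forbids (single x y)) (sym vi) (sym vj) (pat x y) , others
extra-lookup q both i j v e≢0 with trim q (high₂ i j zero (suc zero)) v ≟ 0
... | no t≢0 with vi , vj , others ← trim-lookup q i j zero (suc zero) v t≢0 =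
  subst₂ (Forbids both) (sym vi) (sym vj) 01b , others
... | yes t≡0 with vi , vj , others ← trim-lookup q i j (suc zero) zero v (λ t′≡0 → e≢0 (cong₂ _+_ t≡0 t′≡0)) =
  subst₂ (Forbids both) (sym vi) (sym vj) 10b , others

-- The two patterns of `both` differ at row `i`, so on a column with one of them the summand of the
-- other vanishes.
extra≡trim : ∀ q {l} i j {x y} (v : Vec (Fin (2 + R)) m) → Forbids l x y → lookup v i ≡ x →
  extra q l i j v ≡ trim q (high₂ i j x y) v
extra≡trim q i j v (pat x y) vi = refl
extra≡trim q i j v 01b vi =
  trans (cong (trim q (high₂ i j zero (suc zero)) v +_) (trim-other q i j zero (suc zero) zero v (λ ()) vi)) (+-identityʳ _)
extra≡trim q i j v 10b vi = cong (_+ trim q (high₂ i j (suc zero) zero) v) (trim-other q i j (suc zero) zero (suc zero) v (λ ()) vi)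

extra≤1 : ∀ q l i j (v : Vec (Fin (2 + R)) m) → extra q l i j v ≤ 1
extra≤1 q l i j v with extra q l i j v ≟ 0
... | yes e≡0 = ≤-trans (≤-reflexive e≡0) z≤n
... | no e≢0 = ≤-trans (≤-reflexive (extra≡trim q i j v (proj₁ (extra-lookup q l i j v e≢0)) refl)) (trim≤1 q i j _ _ v)

count-extra : ∀ {q} → 1 ≤ R → q ≤ R ^ (m ∸ 2) → ∀ l i j → i F.< j → count (extra {m} {R} q l i j) ≡ (1 + isBoth l) * q
count-extra {R} {m} {q} 1≤R q≤ l i j i<j = go l
  where
  exact : ∀ x y → count (trim q (high₂ {m} {R} i j x y)) ≡ q
  exact x y = trans (count-trim q (high₂ i j x y)) (m≥n⇒m⊓n≡n (≤-trans q≤ (count-high₂ 1≤R i j x y i<j)))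
  go : ∀ l → count (extra {m} {R} q l i j) ≡ (1 + isBoth l) * q
  go (single x y) = trans (exact (bit x) (bit y)) (sym (+-identityʳ q))
  go both = trans (count-+ (trim q (high₂ i j zero (suc zero))) (trim q (high₂ i j (suc zero) zero)))
    (cong₂ _+_ (exact zero (suc zero)) (trans (exact (suc zero) zero) (sym (+-identityʳ q))))

forbids⇒low : ∀ {l} {x y : Fin (2 + R)} → Forbids l x y → hi x ≡ 0 × hi y ≡ 0
forbids⇒low (pat x y) = low x , low y
  where
  low : ∀ x → hi (bit {R} x) ≡ 0
  low false = refl
  low true = refl
forbids⇒low 01b = refl , refl
forbids⇒low 10b = refl , refl

-- An extra column for `k < l` has its entries below 2 only at `k` and `l`, so a forbidden pattern
-- on `i < j` must sit on that very pair.
pair-unique : {i j k l : Fin m} → i F.< j → k F.< l → (i ≡ k ⊎ i ≡ l) → (j ≡ k ⊎ j ≡ l) → k ≡ i × l ≡ j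
pair-unique i<j k<l (inj₁ refl) (inj₂ refl) = refl , refl
pair-unique i<j k<l (inj₁ refl) (inj₁ refl) = contradiction i<j (<-irrefl refl)
pair-unique i<j k<l (inj₂ refl) (inj₁ refl) = contradiction k<l (<-asym i<j)
pair-unique i<j k<l (inj₂ refl) (inj₂ refl) = contradiction i<j (<-irrefl refl)

-- Matrices for the lower bound.

Copies : ∀ {m n r} → ℕ → RMatrix m n r → Fin m → Fin m → Fin r → Fin r → Set
Copies {n = n} p A i j x y = ∃ λ (τ : Fin p → Fin n) → Injective _≡_ _≡_ τ × (∀ k → A i (τ k) ≡ x × A j (τ k) ≡ y)

copies-swap : ∀ {p} {A : RMatrix m n r} {i j x y} → Copies p A i j x y → Copies p A j i y x
copies-swap (τ , τ-inj , e) = τ , τ-inj , λ k → proj₂ (e k) , proj₁ (e k)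

module Construction {R m : ℕ} (q : ℕ) (l : Label) (good : Vec (Fin (2 + R)) m → ℕ)
  (good≤1 : ∀ v → good v ≤ 1)
  (good≡0 : ∀ v i j → i F.< j → Forbids l (lookup v i) (lookup v j) → good v ≡ 0)
  where

  weight : Vec (Fin (2 + R)) m → ℕ
  weight v = good v + pairSum m (λ i j → extra q l i j v)

  -- A column with a forbidden pattern is not good, and no other pair contributes it, because its
  -- entries at `i` and `j` are below 2.
  weight-forbidden : ∀ v i j → i F.< j → Forbids l (lookup v i) (lookup v j) → weight v ≡ extra q l i j v
  weight-forbidden v i j i<j f =
    cong₂ _+_ (good≡0 v i j i<j f) (pairSum-single m (λ i j → extra q l i j v) i j i<j others)
    where
    others : ∀ k k′ → k F.< k′ → ¬ (k ≡ i × k′ ≡ j) → extra q l k k′ v ≡ 0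
    others k k′ k<k′ kk′≢ij with extra q l k k′ v ≟ 0
    ... | yes e≡0 = e≡0
    ... | no e≢0 = contradiction (pair-unique i<j k<k′ (near i (proj₁ (forbids⇒low f))) (near j (proj₂ (forbids⇒low f)))) kk′≢ij
      where
      near : ∀ a → hi (lookup v a) ≡ 0 → a ≡ k ⊎ a ≡ k′
      near a low with a FP.≟ k | a FP.≟ k′
      ... | yes p | _ = inj₁ p
      ... | no _ | yes p = inj₂ p
      ... | no a≢k | no a≢k′ = contradiction low (proj₂ (extra-lookup q l k k′ v e≢0) a a≢k a≢k′)

  -- A column in some extra family has a forbidden pattern on that pair, so its whole weight comes
  -- from this one family.
  weight≤1 : ∀ v → weight v ≤ 1
  weight≤1 v with pairSum m (λ i j → extra q l i j v) ≟ 0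
  ... | yes p≡0 = ≤-trans (≤-reflexive (trans (cong (good v +_) p≡0) (+-identityʳ _))) (good≤1 v)
  ... | no p≢0 with i , j , i<j , e≢0 ← pairSum≢0 m (λ i j → extra q l i j v) p≢0 =
    ≤-trans (≤-reflexive (weight-forbidden v i j i<j (proj₁ (extra-lookup q l i j v e≢0)))) (extra≤1 q l i j v)

  count-weight : 1 ≤ R → q ≤ R ^ (m ∸ 2) → count good + (1 + isBoth l) * q * (m C 2) ≤ count weight
  count-weight 1≤R q≤ = begin
    count good + (1 + isBoth l) * q * (m C 2)
      ≡⟨ cong (count good +_) (pairSum-const m ((1 + isBoth l) * q)) ⟨
    count good + pairSum m (λ _ _ → (1 + isBoth l) * q)
      ≤⟨ +-monoʳ-≤ (count good) (pairSum-mono m λ i j i<j → ≤-reflexive (sym (count-extra 1≤R q≤ l i j i<j))) ⟩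
    count good + pairSum m (λ i j → count (extra q l i j))
      ≡⟨ cong (count good +_) (count-pairSum m (extra q l)) ⟨
    count good + count (λ v → pairSum m (λ i j → extra q l i j v))
      ≡⟨ count-+ good (λ v → pairSum m (λ i j → extra q l i j v)) ⟨
    count weight ∎
    where open ≤-Reasoning

  -- The columns are distinct points of the support of `weight`. Those with pattern `x`, `y` on
  -- `i < j` all lie in one trimmed family, whose total is at most `q`.
  matrix : 1 ≤ R → q ≤ R ^ (m ∸ 2) → ∃ λ (A : RMatrix m (count good + (1 + isBoth l) * q * (m C 2)) (2 + R)) →
    Simple A × (∀ {p i j x y} → i F.< j → Forbids l x y → Copies p A i j x y → p ≤ q)
  matrix 1≤R q≤ with u , u-inj , w≢0 ← count-choose weight weight≤1 (count-weight 1≤R q≤) =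
    (λ i k → lookup (u k) i) ,
    (λ k k′ e → u-inj (trans (sym (tabulate∘lookup (u k))) (trans (tabulate-cong e) (tabulate∘lookup (u k′))))) ,
    few
    where
    few : ∀ {p i j x y} → i F.< j → Forbids l x y → Copies p (λ i k → lookup (u k) i) i j x y → p ≤ q
    few {p} {i} {j} {x} {y} i<j f (τ , τ-inj , e) = begin
      p                                ≤⟨ card≤count (λ e → τ-inj (u-inj e)) h h≢0 ⟩
      count h                          ≡⟨ count-trim q (high₂ i j x y) ⟩
      count (high₂ i j x y) ⊓ q        ≤⟨ m⊓n≤n _ q ⟩
      q                                ∎
      where
      open ≤-Reasoning
      h : Vec (Fin (2 + R)) m → ℕ
      h = trim q (high₂ i j x y)
      h≢0 : ∀ k → h (u (τ k)) ≢ 0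
      h≢0 k h≡0 = w≢0 (τ k) (trans
        (weight-forbidden (u (τ k)) i j i<j (subst₂ (Forbids l) (sym (proj₁ (e k))) (sym (proj₂ (e k))) f))
        (trans (extra≡trim q i j (u (τ k)) f (proj₁ (e k))) h≡0))

-- Configurations in terms of copies of the four column patterns.

Occurs : ∀ {n} → ℕ → Vec (Fin 2 → ℕ) n → (Fin 2 → ℕ) → Set
Occurs {n} p xs c = ∃ λ (ι : Fin p → Fin n) → Injective _≡_ _≡_ ι × (∀ k → lookup xs (ι k) ≡ c)

occurs-replicate : ∀ p c → Occurs p (replicate p c) c
occurs-replicate p c = id , id , λ k → lookup-replicate k c

occurs-++ˡ : ∀ {p c} (xs : Vec _ m) (ys : Vec _ n) → Occurs p xs c → Occurs p (xs ++ ys) c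
occurs-++ˡ {n = n} xs ys (ι , ι-inj , e) = (_↑ˡ n) ∘ ι , ι-inj ∘ FP.↑ˡ-injective n _ _ ,
  λ k → trans (lookup-++ˡ xs ys (ι k)) (e k)

occurs-++ʳ : ∀ {p c} (xs : Vec _ m) (ys : Vec _ n) → Occurs p ys c → Occurs p (xs ++ ys) c
occurs-++ʳ {m = m} xs ys (ι , ι-inj , e) = (m ↑ʳ_) ∘ ι , ι-inj ∘ FP.↑ʳ-injective m _ _ ,
  λ k → trans (lookup-++ʳ xs ys (ι k)) (e k)

occurs⇒copies : ∀ {k p x y} (xs : Vec (Fin 2 → ℕ) k) (A : RMatrix m n r) {σ : Fin 2 → Fin m} {τ : Fin k → Fin n} →
  Injective _≡_ _≡_ τ → (∀ i j → toℕ (A (σ i) (τ j)) ≡ lookup xs j i) →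
  Occurs p xs (col (toℕ x) (toℕ y)) → Copies p A (σ zero) (σ (suc zero)) x y
occurs⇒copies xs A {σ} {τ} τ-inj entries (ι , ι-inj , e) = τ ∘ ι , ι-inj ∘ τ-inj , λ k →
  FP.toℕ-injective (trans (entries zero (ι k)) (cong (λ f → f zero) (e k))) ,
  FP.toℕ-injective (trans (entries (suc zero) (ι k)) (cong (λ f → f (suc zero)) (e k)))

FourCopies : ∀ {m n R} (a b c d : ℕ) → RMatrix m n (2 + R) → Fin m → Fin m → Set
FourCopies a b c d A i j = Copies a A i j zero zero × Copies b A i j (suc zero) zero ×
  Copies c A i j zero (suc zero) × Copies d A i j (suc zero) (suc zero)

≺⇒copies : ∀ a b c d (A : RMatrix m n (2 + R)) → FMat a b c d ≺ A → ∃₂ λ i j → i ≢ j × FourCopies a b c d A i j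
≺⇒copies a b c d A (σ , τ , σ-inj , τ-inj , entries) =
  σ zero , σ (suc zero) , (λ e → contradiction (σ-inj e) λ ()) ,
  found (occurs-++ˡ xabc xd (occurs-++ˡ xab xc (occurs-++ˡ xa xb (occurs-replicate a (col 0 0))))) ,
  found (occurs-++ˡ xabc xd (occurs-++ˡ xab xc (occurs-++ʳ xa xb (occurs-replicate b (col 1 0))))) ,
  found (occurs-++ˡ xabc xd (occurs-++ʳ xab xc (occurs-replicate c (col 0 1)))) ,
  found (occurs-++ʳ xabc xd (occurs-replicate d (col 1 1)))
  where
  xa = replicate a (col 0 0)
  xb = replicate b (col 1 0)
  xc = replicate c (col 0 1)
  xd = replicate d (col 1 1)
  xab = xa ++ xb
  xabc = xab ++ xc
  found : ∀ {p x y} → Occurs p (FCols a b c d) (col (toℕ x) (toℕ y)) → Copies p A (σ zero) (σ (suc zero)) x y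
  found = occurs⇒copies (FCols a b c d) A τ-inj entries

-- The patterns 00, 10, 01, 11 get the codes 0, 1, 2, 3, in the order of the blocks of `FCols`.
code : (Fin 2 → ℕ) → ℕ
code c = c zero + 2 * c (suc zero)

Embeds : ∀ {k m n r} → RMatrix m n r → Fin m → Fin m → Vec (Fin 2 → ℕ) k → Set
Embeds {k} {n = n} A i j xs = ∃ λ (τ : Fin k → Fin n) → Injective _≡_ _≡_ τ ×
  (∀ s → toℕ (A i (τ s)) ≡ lookup xs s zero × toℕ (A j (τ s)) ≡ lookup xs s (suc zero))

embeds-replicate : ∀ {p} {A : RMatrix m n r} {i j x y} → Copies p A i j x y → Embeds A i j (replicate p (col (toℕ x) (toℕ y)))
embeds-replicate {x = x} {y} (τ , τ-inj , e) = τ , τ-inj , λ s →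
  trans (cong toℕ (proj₁ (e s))) (cong (λ f → f zero) (sym (lookup-replicate s (col (toℕ x) (toℕ y))))) ,
  trans (cong toℕ (proj₂ (e s))) (cong (λ f → f (suc zero)) (sym (lookup-replicate s (col (toℕ x) (toℕ y)))))

lookup-++-elim : ∀ {a p} {B : Set a} {xs : Vec B m} {ys : Vec B n} (P : B → Set p) →
  (∀ s → P (lookup xs s)) → (∀ t → P (lookup ys t)) → ∀ k → P (lookup (xs ++ ys) k)
lookup-++-elim {xs = []} P pxs pys k = pys k
lookup-++-elim {xs = x ∷ xs} P pxs pys zero = pxs zero
lookup-++-elim {xs = x ∷ xs} P pxs pys (suc k) = lookup-++-elim {xs = xs} P (pxs ∘ suc) pys k

-- The codes separate the two blocks, so that their embeddings have disjoint images.
embeds-snoc : ∀ {k p} {A : RMatrix m n r} {i j x y} {xs : Vec (Fin 2 → ℕ) k} →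
  (∀ s → code (lookup xs s) < code (col (toℕ x) (toℕ y))) → Embeds A i j xs → Copies p A i j x y →
  Embeds A i j (xs ++ replicate p (col (toℕ x) (toℕ y)))
embeds-snoc {m} {n} {r} {k} {p} {A} {i} {j} {x} {y} {xs} below (τ , τ-inj , τ-e) copies = τ″ ∘ splitAt k , inj , entries
  where
  ys : Vec (Fin 2 → ℕ) p
  ys = replicate p (col (toℕ x) (toℕ y))
  block : Embeds A i j ys
  block = embeds-replicate {A = A} copies
  τ′ : Fin p → Fin n
  τ′ = proj₁ block
  τ″ : Fin k ⊎ Fin p → Fin n
  τ″ = [ τ , τ′ ]′
  disjoint : ∀ s t → τ s ≢ τ′ t
  disjoint s t e = <-irrefl (trans (sym same) (cong code (lookup-replicate t (col (toℕ x) (toℕ y))))) (below s)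
    where
    same : code (lookup ys t) ≡ code (lookup xs s)
    same = sym (cong₂ (λ a b → a + 2 * b)
      (trans (sym (proj₁ (τ-e s))) (trans (cong (toℕ ∘ A i) e) (proj₁ (proj₂ (proj₂ block) t))))
      (trans (sym (proj₂ (τ-e s))) (trans (cong (toℕ ∘ A j) e) (proj₂ (proj₂ (proj₂ block) t)))))
  τ″-inj : ∀ s t → τ″ s ≡ τ″ t → s ≡ t
  τ″-inj (inj₁ s) (inj₁ t) e = cong inj₁ (τ-inj e)
  τ″-inj (inj₂ s) (inj₂ t) e = cong inj₂ (proj₁ (proj₂ block) e)
  τ″-inj (inj₁ s) (inj₂ t) e = contradiction e (disjoint s t)
  τ″-inj (inj₂ s) (inj₁ t) e = contradiction (sym e) (disjoint t s)
  inj : Injective _≡_ _≡_ (τ″ ∘ splitAt k)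
  inj {s} {t} e = trans (sym (FP.join-splitAt k p s)) (trans (cong (F.join k p) (τ″-inj (splitAt k s) (splitAt k t) e)) (FP.join-splitAt k p t))
  entries : ∀ s → toℕ (A i (τ″ (splitAt k s))) ≡ lookup (xs ++ ys) s zero × toℕ (A j (τ″ (splitAt k s))) ≡ lookup (xs ++ ys) s (suc zero)
  entries s with splitAt k s in split
  ... | inj₁ t rewrite sym (FP.splitAt⁻¹-↑ˡ split) | lookup-++ˡ xs ys t = τ-e t
  ... | inj₂ t rewrite sym (FP.splitAt⁻¹-↑ʳ split) | lookup-++ʳ xs ys t = proj₂ (proj₂ block) t

pick : Fin m → Fin m → Fin 2 → Fin m
pick i j zero = i
pick i j (suc _) = j

pick-injective : {i j : Fin m} → i ≢ j → Injective _≡_ _≡_ (pick i j)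
pick-injective i≢j {zero} {zero} _ = refl
pick-injective i≢j {zero} {suc zero} e = contradiction e i≢j
pick-injective i≢j {suc zero} {zero} e = contradiction (sym e) i≢j
pick-injective i≢j {suc zero} {suc zero} _ = refl

copies⇒≺ : ∀ a b c d (A : RMatrix m n (2 + R)) {i j} → i ≢ j → FourCopies a b c d A i j → FMat a b c d ≺ A
copies⇒≺ a b c d A {i} {j} i≢j (ca , cb , cc , cd) =
  pick i j , proj₁ embedding , pick-injective i≢j , proj₁ (proj₂ embedding) ,
  λ { zero s → proj₁ (proj₂ (proj₂ embedding) s) ; (suc zero) s → proj₂ (proj₂ (proj₂ embedding) s) }
  where
  xa = replicate a (col 0 0)
  xb = replicate b (col 1 0)
  xc = replicate c (col 0 1)
  constant : ∀ {t} p x → code x < t → ∀ s → code (lookup (replicate p x) s) < t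
  constant p x x<t s = ≤-<-trans (≤-reflexive (cong code (lookup-replicate s x))) x<t
  -- The bounds 1, 2 and 3 are the codes of the blocks to be appended next.
  below-b : ∀ s → code (lookup xa s) < 1
  below-b = constant a (col 0 0) (s≤s z≤n)
  below-c : ∀ s → code (lookup (xa ++ xb) s) < 2
  below-c = lookup-++-elim {xs = xa} (λ x → code x < 2) (m<n⇒m<1+n ∘ below-b) (constant b (col 1 0) ≤-refl)
  below-d : ∀ s → code (lookup ((xa ++ xb) ++ xc) s) < 3
  below-d = lookup-++-elim {xs = xa ++ xb} (λ x → code x < 3) (m<n⇒m<1+n ∘ below-c) (constant c (col 0 1) ≤-refl)
  embedding : Embeds A i j (FCols a b c d)
  embedding = embeds-snoc {A = A} {xs = (xa ++ xb) ++ xc} below-d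
    (embeds-snoc {A = A} {xs = xa ++ xb} below-c (embeds-snoc {A = A} {xs = xa} below-b (embeds-replicate {A = A} ca) cb) cc) cd

-- Upper bound for matrices that avoid F(a,b,c,d).

num : RMatrix m n r → Fin m → Fin m → Fin r → Fin r → ℕ
num A i j x y = sum (λ k → eq x (A i k) * eq y (A j k))

num⇒copies : ∀ {p} (A : RMatrix m n r) i j x y → p ≤ num A i j x y → Copies p A i j x y
num⇒copies A i j x y p≤
  with τ , τ-inj , e≢0 ← sum-choose (λ k → eq x (A i k) * eq y (A j k)) (λ k → *-mono-≤ (eq≤1 x (A i k)) (eq≤1 y (A j k))) p≤ =
  τ , τ-inj , λ k → sym (eq≢0 x _ (proj₁ (*≢0 _ (eq y (A j (τ k))) (e≢0 k)))) , sym (eq≢0 y _ (proj₂ (*≢0 (eq x (A i (τ k))) _ (e≢0 k))))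

forbNum : Label → RMatrix m n (2 + R) → Fin m → Fin m → ℕ
forbNum (single x y) A i j = num A i j (bit x) (bit y)
forbNum both A i j = num A i j zero (suc zero) + num A i j (suc zero) zero

sum-forb : ∀ l (A : RMatrix m n (2 + R)) i j → sum (λ k → forb l (A i k) (A j k)) ≡ forbNum l A i j
sum-forb (single x y) A i j = refl
sum-forb both A i j = ∑-distrib-+ (λ k → eq zero (A i k) * eq (suc zero) (A j k)) _

-- Simplicity bounds the multiplicity of each column by 1, so the deletion applies to the
-- multiplicity weight, whose total is `n`.
columns≤good+forbidden : (A : RMatrix m n (2 + R)) → Simple A → (L : Fin m → Fin m → Label) (bound : Fin m → Fin m → ℕ) →
  (∀ i j → i F.< j → forbNum (L i j) A i j ≤ bound i j) →
  ∃ λ (g : Vec (Fin (2 + R)) m → ℕ) → (∀ v → g v ≤ 1) ×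
    (∀ v i j → i F.< j → Forbids (L i j) (lookup v i) (lookup v j) → g v ≡ 0) ×
    n ≤ count g + pairSum m bound
columns≤good+forbidden {m} {n} {R} A simple L bound few =
  let g , g≤1 , g≡0 , P≤ = count≤good+forbidden L (multiplicity column) (multiplicity≤1 column-inj) bound few′ in
  g , g≤1 , g≡0 , ≤-trans (≤-reflexive (sym count-columns)) P≤
  where
  column : Fin n → Vec (Fin (2 + R)) m
  column k = tabulate (λ i → A i k)
  column-inj : Injective _≡_ _≡_ column
  column-inj {k} {k′} e = simple k k′ λ i →
    trans (sym (lookup∘tabulate (λ i → A i k) i)) (trans (cong (λ v → lookup v i) e) (lookup∘tabulate (λ i → A i k′) i))
  count-columns : count (multiplicity column) ≡ n
  count-columns = trans (count-cong λ v → sym (*-identityʳ (multiplicity column v)))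
    (trans (count-multiplicity column (const 1)) (trans (sum-const n 1) (*-identityʳ n)))
  few′ : ∀ i j → i F.< j → count (λ v → multiplicity column v * forb (L i j) (lookup v i) (lookup v j)) ≤ bound i j
  few′ i j i<j = ≤-trans (≤-reflexive (trans (count-multiplicity column (λ v → forb (L i j) (lookup v i) (lookup v j)))
    (trans (sum-cong-≗ λ k → cong₂ (forb (L i j)) (lookup∘tabulate (λ i → A i k) i) (lookup∘tabulate (λ i → A i k) j)) (sum-forb (L i j) A i j))))
    (few i j i<j)

n≤m∸1 : ∀ {n m} → n < m → n ≤ m ∸ 1
n≤m∸1 (s≤s n≤m) = n≤m

-- The bound allows a pair labelled both an excess of R ^ (m ∸ 2): the number of columns with a fixed
-- pattern on that pair and entries at least 2 elsewhere, by which count-forbidding improves.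
columns≤ : 1 ≤ R → ∀ q (A : RMatrix m n (2 + R)) → Simple A →
  (∀ i j → i F.< j → ∃ λ l → forbNum l A i j ≤ q + isBoth l * R ^ (m ∸ 2)) →
  n ≤ mainTerm R m + q * (m C 2)
columns≤ {R} {m} {n} 1≤R q A simple labels =
  let g , g≤1 , g≡0 , n≤ = columns≤good+forbidden A simple L (λ i j → q + S i j) few in begin
  n                                                  ≤⟨ n≤ ⟩
  count g + pairSum m (λ i j → q + S i j)            ≡⟨ cong (count g +_) (pairSum-+ m (λ _ _ → q) S) ⟩
  count g + (pairSum m (λ _ _ → q) + pairSum m S)    ≡⟨ arrange (count g) _ _ ⟩
  (count g + pairSum m S) + pairSum m (λ _ _ → q)    ≤⟨ +-mono-≤ (count-forbidding 1≤R m L g g≤1 g≡0) (≤-reflexive (pairSum-const m q)) ⟩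
  mainTerm R m + q * (m C 2)                         ∎
  where
  open ≤-Reasoning
  total : ∀ i j → ∃ λ l → i F.< j → forbNum l A i j ≤ q + isBoth l * R ^ (m ∸ 2)
  total i j with i FP.<? j
  ... | yes i<j = proj₁ (labels i j i<j) , λ _ → proj₂ (labels i j i<j)
  -- Labels are given for `i < j` only; `both` is a default that makes `L` total.
  ... | no i≮j = both , λ i<j → contradiction i<j i≮j
  L : Fin m → Fin m → Label
  L i j = proj₁ (total i j)
  S : Fin m → Fin m → ℕ
  S i j = isBoth (L i j) * R ^ (m ∸ 2)
  few : ∀ i j → i F.< j → forbNum (L i j) A i j ≤ q + S i j
  few i j = proj₂ (total i j)
  arrange : ∀ a b c → a + (b + c) ≡ (a + c) + b
  arrange = solve-∀

fourCopies-swap : ∀ a b c d (A : RMatrix m n (2 + R)) {i j} → FourCopies a b c d A i j → FourCopies a c b d A j i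
fourCopies-swap a b c d A (ca , cb , cc , cd) =
  copies-swap {A = A} ca , copies-swap {A = A} cc , copies-swap {A = A} cb , copies-swap {A = A} cd

-- If no single pattern is rare on a pair, then 10 and 01 both occur at least `b ⊓ c` times. Neither
-- can reach `b ⊔ c`, since then F would occur in one of the two row orders; so the label `both`
-- applies.
FMat-upper : 1 ≤ R → ∀ a b c d → 2 * (a ⊔ b ⊔ c ⊔ d) ≤ R ^ (m ∸ 2) →
  (A : RMatrix m n (2 + R)) → Simple A → ¬ (FMat a b c d ≺ A) →
  n ≤ mainTerm R m + ((a ⊔ d ⊔ (b ⊓ c)) ∸ 1) * (m C 2)
FMat-upper {R} {m} 1≤R a b c d 2μ≤ A simple avoids = columns≤ 1≤R (α ∸ 1) A simple labels
  where
  α μ : ℕ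
  α = a ⊔ d ⊔ (b ⊓ c)
  μ = a ⊔ b ⊔ c ⊔ d
  a≤α : a ≤ α
  a≤α = ≤-trans (m≤m⊔n a d) (m≤m⊔n (a ⊔ d) (b ⊓ c))
  d≤α : d ≤ α
  d≤α = ≤-trans (m≤n⊔m a d) (m≤m⊔n (a ⊔ d) (b ⊓ c))
  b⊓c≤α : b ⊓ c ≤ α
  b⊓c≤α = m≤n⊔m (a ⊔ d) (b ⊓ c)
  b⊔c≤μ : b ⊔ c ≤ μ
  b⊔c≤μ = ⊔-lub (≤-trans (m≤n⊔m a b) (≤-trans (m≤m⊔n (a ⊔ b) c) (m≤m⊔n _ d))) (≤-trans (m≤n⊔m (a ⊔ b) c) (m≤m⊔n _ d))
  labels : ∀ i j → i F.< j → ∃ λ l → forbNum l A i j ≤ (α ∸ 1) + isBoth l * R ^ (m ∸ 2)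
  labels i j i<j = choose
    where
    n₀₀ n₁₀ n₀₁ n₁₁ : ℕ
    n₀₀ = num A i j zero zero
    n₁₀ = num A i j (suc zero) zero
    n₀₁ = num A i j zero (suc zero)
    n₁₁ = num A i j (suc zero) (suc zero)
    i≢j : i ≢ j
    i≢j refl = <-irrefl refl i<j
    absent : ¬ (a ≤ n₀₀ × b ≤ n₁₀ × c ≤ n₀₁ × d ≤ n₁₁)
    absent (ha , hb , hc , hd) = avoids (copies⇒≺ a b c d A i≢j
      (num⇒copies A i j _ _ ha , num⇒copies A i j _ _ hb , num⇒copies A i j _ _ hc , num⇒copies A i j _ _ hd))
    absent′ : ¬ (a ≤ n₀₀ × c ≤ n₁₀ × b ≤ n₀₁ × d ≤ n₁₁)
    absent′ (ha , hc , hb , hd) = avoids (copies⇒≺ a b c d A (i≢j ∘ sym) (fourCopies-swap a c b d A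
      (num⇒copies A i j _ _ ha , num⇒copies A i j _ _ hc , num⇒copies A i j _ _ hb , num⇒copies A i j _ _ hd)))
    -- The final `0` is what the excess `isBoth l * R ^ (m ∸ 2)` computes to for a single pattern.
    few : ∀ {p k} → k < p → p ≤ α → k ≤ (α ∸ 1) + 0
    few k<p p≤α = ≤-trans (n≤m∸1 (<-≤-trans k<p p≤α)) (m≤m+n _ 0)
    choose : ∃ λ l → forbNum l A i j ≤ (α ∸ 1) + isBoth l * R ^ (m ∸ 2)
    choose with n₀₀ <? a | n₁₁ <? d | n₁₀ <? b ⊓ c | n₀₁ <? b ⊓ c | n₁₀ <? b ⊔ c | n₀₁ <? b ⊔ c
    ... | yes lt | _ | _ | _ | _ | _ = single false false , few lt a≤α
    ... | no _ | yes lt | _ | _ | _ | _ = single true true , few lt d≤α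
    ... | no _ | no _ | yes lt | _ | _ | _ = single true false , few lt b⊓c≤α
    ... | no _ | no _ | no _ | yes lt | _ | _ = single false true , few lt b⊓c≤α
    ... | no _ | no _ | no _ | no _ | yes lt₁₀ | yes lt₀₁ = both , (begin
      n₀₁ + n₁₀                        ≤⟨ +-mono-≤ (≤-trans (<⇒≤ lt₀₁) b⊔c≤μ) (≤-trans (<⇒≤ lt₁₀) b⊔c≤μ) ⟩
      μ + μ                            ≡⟨ cong (μ +_) (+-identityʳ μ) ⟨
      2 * μ                            ≤⟨ 2μ≤ ⟩
      R ^ (m ∸ 2)                      ≡⟨ +-identityʳ _ ⟨
      1 * R ^ (m ∸ 2)                  ≤⟨ m≤n+m _ (α ∸ 1) ⟩
      (α ∸ 1) + 1 * R ^ (m ∸ 2)        ∎)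
      where open ≤-Reasoning
    -- One pattern reaches `b ⊔ c` and the other `b ⊓ c`; which of `b` and `c` is smaller decides
    -- the row order in which F appears.
    ... | no ha | no hd | no h₁₀ | no h₀₁ | no H₁₀ | _ with ⊓-sel b c
    ...   | inj₁ b⊓c≡b = contradiction (≮⇒≥ ha , ≤-trans (m≤n⊔m b c) (≮⇒≥ H₁₀) , ≤-trans (≤-reflexive (sym b⊓c≡b)) (≮⇒≥ h₀₁) , ≮⇒≥ hd) absent′
    ...   | inj₂ b⊓c≡c = contradiction (≮⇒≥ ha , ≤-trans (m≤m⊔n b c) (≮⇒≥ H₁₀) , ≤-trans (≤-reflexive (sym b⊓c≡c)) (≮⇒≥ h₀₁) , ≮⇒≥ hd) absent
    choose | no ha | no hd | no h₁₀ | no h₀₁ | yes _ | no H₀₁ with ⊓-sel b c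
    ...   | inj₁ b⊓c≡b = contradiction (≮⇒≥ ha , ≤-trans (≤-reflexive (sym b⊓c≡b)) (≮⇒≥ h₁₀) , ≤-trans (m≤n⊔m b c) (≮⇒≥ H₀₁) , ≮⇒≥ hd) absent
    ...   | inj₂ b⊓c≡c = contradiction (≮⇒≥ ha , ≤-trans (≤-reflexive (sym b⊓c≡c)) (≮⇒≥ h₁₀) , ≤-trans (m≤m⊔n b c) (≮⇒≥ H₀₁) , ≮⇒≥ hd) absent′

-- Lower bound for F(a,b,c,d).

single-lower : 1 ≤ R → ∀ x y {q} → q ≤ R ^ (m ∸ 2) →
  ∃ λ (A : RMatrix m (mainTerm R m + q * (m C 2)) (2 + R)) →
    Simple A × (∀ {p i j} → i F.< j → Copies p A i j (bit x) (bit y) → p ≤ q)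
single-lower {R} {m} 1≤R x y {q} q≤ =
  let A , simple , few = Construction.matrix q (single x y) (ordered (bit x) (bit y)) (ordered≤1 (bit x) (bit y)) good≡0 1≤R q≤ in
  subst (λ N → ∃ λ (A : RMatrix m N (2 + R)) → Simple A × (∀ {p i j} → i F.< j → Copies p A i j (bit x) (bit y) → p ≤ q))
    (cong₂ _+_ (count-ordered m (bit x) (bit y)) (cong (_* (m C 2)) (+-identityʳ q)))
    (A , simple , λ i<j → few i<j (pat x y))
  where
  good≡0 : ∀ v i j → i F.< j → Forbids (single x y) (lookup v i) (lookup v j) → ordered (bit {R} x) (bit y) v ≡ 0
  good≡0 v i j i<j f = go f refl refl
    where
    go : ∀ {s t} → Forbids (single x y) s t → s ≡ lookup v i → t ≡ lookup v j → ordered (bit x) (bit y) v ≡ 0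
    go (pat _ _) s≡ t≡ = trans (cong₂ (λ s t → ordered s t v) s≡ t≡) (ordered-lookup v i j i<j)

both-lower : 1 ≤ R → ∀ {q} → q ≤ R ^ (m ∸ 2) →
  ∃ λ (A : RMatrix m (2 * suc R ^ m ∸ R ^ m + q * (m * (m ∸ 1))) (2 + R)) →
    Simple A × (∀ {p i j x y} → i F.< j → Forbids both x y → Copies p A i j x y → p ≤ q)
both-lower {R} {m} 1≤R {q} q≤ =
  subst (λ N → ∃ λ (A : RMatrix m N (2 + R)) → Simple A × (∀ {p i j x y} → i F.< j → Forbids both x y → Copies p A i j x y → p ≤ q))
    (cong₂ _+_ count≡ (2q*C2 q m))
    (Construction.matrix q both oneSided oneSided≤1 oneSided-lookup 1≤R q≤)
  where
  count≡ : count (oneSided {R} {m}) ≡ 2 * suc R ^ m ∸ R ^ m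
  count≡ = trans (sym (m+n∸n≡m _ (R ^ m))) (cong (_∸ R ^ m) (count-oneSided R m))

FMat-avoids : ∀ a b c d (A : RMatrix m n (2 + R)) →
  (∀ {i j} → i F.< j → ¬ FourCopies a b c d A i j) → (∀ {i j} → i F.< j → ¬ FourCopies a c b d A i j) →
  ¬ (FMat a b c d ≺ A)
FMat-avoids a b c d A absent absent′ F≺A with i , j , i≢j , copies ← ≺⇒copies a b c d A F≺A with FP.<-cmp i j
... | tri< i<j _ _ = absent i<j copies
... | tri≈ _ i≡j _ = i≢j i≡j
... | tri> _ _ j<i = absent′ j<i (fourCopies-swap a b c d A copies)

too-many : ∀ {α p} → 0 < α → α ≤ p → ¬ (p ≤ α ∸ 1)
too-many {suc α} _ α<p p≤α = <-irrefl refl (<-≤-trans α<p p≤α)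

-- Exchanging the rows of F swaps `b` and `c`, so pattern 01 on `i < j` is required at least `b ⊓ c`
-- times in either order, while the demand for 00 and 11 stays the same.
FMat-lower : 1 ≤ R → ∀ a b c d → let α = a ⊔ d ⊔ (b ⊓ c) in 0 < α → α ∸ 1 ≤ R ^ (m ∸ 2) →
  ∃ λ (A : RMatrix m (mainTerm R m + (α ∸ 1) * (m C 2)) (2 + R)) → Simple A × ¬ (FMat a b c d ≺ A)
FMat-lower {R} {m} 1≤R a b c d 0<α q≤ with ⊔-sel (a ⊔ d) (b ⊓ c)
... | inj₂ α≡b⊓c with A , simple , few ← single-lower {m = m} 1≤R false true q≤ = A , simple , FMat-avoids a b c d A
  (λ i<j (_ , _ , cc , _) → too-many 0<α (≤-trans (≤-reflexive α≡b⊓c) (m⊓n≤n b c)) (few i<j cc))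
  (λ i<j (_ , _ , cb , _) → too-many 0<α (≤-trans (≤-reflexive α≡b⊓c) (m⊓n≤m b c)) (few i<j cb))
... | inj₁ α≡a⊔d with ⊔-sel a d
...   | inj₁ a⊔d≡a with A , simple , few ← single-lower {m = m} 1≤R false false q≤ = A , simple , FMat-avoids a b c d A
  (λ i<j (ca , _) → too-many 0<α (≤-reflexive (trans α≡a⊔d a⊔d≡a)) (few i<j ca))
  (λ i<j (ca , _) → too-many 0<α (≤-reflexive (trans α≡a⊔d a⊔d≡a)) (few i<j ca))
...   | inj₂ a⊔d≡d with A , simple , few ← single-lower {m = m} 1≤R true true q≤ = A , simple , FMat-avoids a b c d A
  (λ i<j (_ , _ , _ , cd) → too-many 0<α (≤-reflexive (trans α≡a⊔d a⊔d≡d)) (few i<j cd))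
  (λ i<j (_ , _ , _ , cd) → too-many 0<α (≤-reflexive (trans α≡a⊔d a⊔d≡d)) (few i<j cd))

-- The case of p copies of a single column with entries 0 and 1.

pCol≺⇒copies : ∀ {p} (A : RMatrix m n (2 + R)) → pCol p ≺ A → ∃₂ λ i j → i ≢ j × Copies p A i j zero (suc zero)
pCol≺⇒copies A (σ , τ , σ-inj , τ-inj , entries) =
  σ zero , σ (suc zero) , (λ e → contradiction (σ-inj e) λ ()) ,
  τ , τ-inj , λ k → FP.toℕ-injective (entries zero k) , FP.toℕ-injective (entries (suc zero) k)

copies⇒pCol≺ : ∀ {p} (A : RMatrix m n (2 + R)) {i j} → i ≢ j → Copies p A i j zero (suc zero) → pCol p ≺ A
copies⇒pCol≺ A {i} {j} i≢j (τ , τ-inj , e) = pick i j , τ , pick-injective i≢j , τ-inj ,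
  λ { zero k → cong toℕ (proj₁ (e k)) ; (suc zero) k → cong toℕ (proj₂ (e k)) }

-- As the rows may be taken in either order, avoidance means that 01 and 10 each occur at most
-- `p ∸ 1` times on every pair. This is the label `both` with `q = p ∸ 1` throughout, and `2q`
-- columns per pair give the last term.
isForb-pCol : 1 ≤ R → ∀ {p} → 0 < p → p ∸ 1 ≤ R ^ (m ∸ 2) →
  IsForb m (2 + R) (pCol p) (2 * suc R ^ m ∸ R ^ m + (p ∸ 1) * (m * (m ∸ 1)))
isForb-pCol {R} {m} 1≤R {p} 0<p q≤ =
  let A , simple , few = both-lower {m = m} 1≤R q≤ in (A , simple , avoids A few) , upper
  where
  avoids : ∀ {n} (A : RMatrix m n (2 + R)) →
    (∀ {p′ i j x y} → i F.< j → Forbids both x y → Copies p′ A i j x y → p′ ≤ p ∸ 1) → ¬ (pCol p ≺ A)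
  avoids A few F≺A with i , j , i≢j , copies ← pCol≺⇒copies A F≺A with FP.<-cmp i j
  ... | tri< i<j _ _ = too-many 0<p ≤-refl (few i<j 01b copies)
  ... | tri≈ _ i≡j _ = i≢j i≡j
  ... | tri> _ _ j<i = too-many 0<p ≤-refl (few j<i 10b (copies-swap {A = A} copies))
  upper : ∀ n (A : RMatrix m n (2 + R)) → Simple A → ¬ (pCol p ≺ A) →
    n ≤ 2 * suc R ^ m ∸ R ^ m + (p ∸ 1) * (m * (m ∸ 1))
  upper n A simple avoids =
    let g , g≤1 , g≡0 , n≤ = columns≤good+forbidden A simple (λ _ _ → both) (λ _ _ → 2 * (p ∸ 1)) few in begin
    n                                                     ≤⟨ n≤ ⟩
    count g + pairSum m (λ _ _ → 2 * (p ∸ 1))             ≤⟨ +-mono-≤ (count-forbidding-both m g g≤1 g≡0) (≤-reflexive size) ⟩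
    2 * suc R ^ m ∸ R ^ m + (p ∸ 1) * (m * (m ∸ 1))       ∎
    where
    open ≤-Reasoning
    size : pairSum m (λ _ _ → 2 * (p ∸ 1)) ≡ (p ∸ 1) * (m * (m ∸ 1))
    size = trans (pairSum-const m (2 * (p ∸ 1))) (2q*C2 (p ∸ 1) m)
    few : ∀ i j → i F.< j → forbNum both A i j ≤ 2 * (p ∸ 1)
    few i j i<j = +-mono-≤
      (n≤m∸1 (≰⇒> λ p≤ → avoids (copies⇒pCol≺ A i≢j (num⇒copies A i j _ _ p≤))))
      -- `2 * (p ∸ 1)` unfolds to a sum whose second summand ends in `+ 0`.
      (≤-trans (n≤m∸1 (≰⇒> λ p≤ → avoids (copies⇒pCol≺ A (i≢j ∘ sym) (copies-swap {A = A} (num⇒copies A i j _ _ p≤))))) (m≤m+n _ 0))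
      where
      i≢j : i ≢ j
      i≢j refl = <-irrefl refl i<j

-- Containment is compared rather than the matrices themselves, since the column numbers of
-- `FMat 0 b c 0` and `pCol (b ⊔ c)` do not agree by computation.
IsForb-cong : ∀ {k l k′ l′ N} {F : NMatrix k l} {G : NMatrix k′ l′} →
  (∀ {n} (A : RMatrix m n r) → F ≺ A → G ≺ A) → (∀ {n} (A : RMatrix m n r) → G ≺ A → F ≺ A) →
  IsForb m r F N → IsForb m r G N
IsForb-cong to from ((A , simple , avoids) , upper) =
  (A , simple , avoids ∘ from A) , λ n A simple avoids → upper n A simple (avoids ∘ to A)

no-copies : ∀ (A : RMatrix m n r) {i j x y} → Copies 0 A i j x y
no-copies A = (λ ()) , (λ { {()} }) , λ ()

-- One of `b` and `c` is 0. If it is `b`, the columns of F are those of `pCol`; if it is `c`, the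
-- two rows are exchanged.
isForb-FMat-pCol : ∀ {N} b c → b ⊓ c ≡ 0 → IsForb m (2 + R) (pCol (b ⊔ c)) N → IsForb m (2 + R) (FMat 0 b c 0) N
isForb-FMat-pCol {m} {R} zero c _ = IsForb-cong
  (λ A F≺A → let i , j , i≢j , copies = pCol≺⇒copies A F≺A in
    copies⇒≺ 0 0 c 0 A i≢j (no-copies A , no-copies A , copies , no-copies A))
  (λ A F≺A → let i , j , i≢j , _ , _ , copies , _ = ≺⇒copies 0 0 c 0 A F≺A in copies⇒pCol≺ A i≢j copies)
isForb-FMat-pCol {m} {R} b@(suc _) zero _ = IsForb-cong
  (λ A F≺A → let i , j , i≢j , copies = pCol≺⇒copies A F≺A in
    copies⇒≺ 0 b 0 0 A (i≢j ∘ sym) (no-copies A , copies-swap {A = A} copies , no-copies A , no-copies A))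
  (λ A F≺A → let i , j , i≢j , _ , copies , _ = ≺⇒copies 0 b 0 0 A F≺A in
    copies⇒pCol≺ A (i≢j ∘ sym) (copies-swap {A = A} copies))

theorem6p2 : (r m a b c d : ℕ) → 3 < r → 2 ≤ m →
    ¬ (a + b + c + d ≡ 0) →
    2 * (a ⊔ b ⊔ c ⊔ d) ≤ (r ∸ 2) ^ (m ∸ 2) →
    (0 < a ⊔ d ⊔ (b ⊓ c) →
    IsForb m r (FMat a b c d)
    (m * (r ∸ 1) ^ (m ∸ 1) + (r ∸ 1) ^ m + ((a ⊔ d ⊔ (b ⊓ c)) ∸ 1) * (m C 2)))
    × (a ⊔ d ⊔ (b ⊓ c) ≡ 0 →
    IsForb m r (FMat a b c d)
    (2 * (r ∸ 1) ^ m ∸ (r ∸ 2) ^ m + ((b ⊔ c) ∸ 1) * (m * (m ∸ 1)))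
    × IsForb m r (pCol (b ⊔ c))
    (2 * (r ∸ 1) ^ m ∸ (r ∸ 2) ^ m + ((b ⊔ c) ∸ 1) * (m * (m ∸ 1))))
theorem6p2 (suc (suc R)) m a b c d (s≤s (s≤s 1<R)) 2≤m F≢∅ 2μ≤ = positive , vanishing
  where
  1≤R : 1 ≤ R
  1≤R = <⇒≤ 1<R
  μ : ℕ
  μ = a ⊔ b ⊔ c ⊔ d
  a≤μ : a ≤ μ
  a≤μ = ≤-trans (m≤m⊔n a b) (≤-trans (m≤m⊔n (a ⊔ b) c) (m≤m⊔n _ d))
  b≤μ : b ≤ μ
  b≤μ = ≤-trans (m≤n⊔m a b) (≤-trans (m≤m⊔n (a ⊔ b) c) (m≤m⊔n _ d))
  c≤μ : c ≤ μ
  c≤μ = ≤-trans (m≤n⊔m (a ⊔ b) c) (m≤m⊔n _ d)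
  fits : ∀ {x} → x ≤ μ → x ∸ 1 ≤ R ^ (m ∸ 2)
  -- Each pair has at least `R ^ (m ∸ 2)` candidates for its extra columns, which is enough for a
  -- quota of `x ∸ 1`.
  fits {x} x≤μ = ≤-trans (m∸n≤m x 1) (≤-trans x≤μ (≤-trans (m≤m+n μ _) 2μ≤))
  positive : 0 < a ⊔ d ⊔ (b ⊓ c) → IsForb m (2 + R) (FMat a b c d) (mainTerm R m + ((a ⊔ d ⊔ (b ⊓ c)) ∸ 1) * (m C 2))
  positive 0<α =
    FMat-lower {m = m} 1≤R a b c d 0<α (fits (⊔-lub (⊔-lub a≤μ (m≤n⊔m _ d)) (≤-trans (m⊓n≤m b c) b≤μ))) ,
    λ n → FMat-upper 1≤R a b c d 2μ≤
  vanishing : a ⊔ d ⊔ (b ⊓ c) ≡ 0 → _ × _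
  vanishing α≡0 = subst₂ (λ a d → IsForb m (2 + R) (FMat a b c d) N) (sym a≡0) (sym d≡0) (isForb-FMat-pCol b c b⊓c≡0 forb-pCol) , forb-pCol
    where
    N : ℕ
    N = 2 * suc R ^ m ∸ R ^ m + ((b ⊔ c) ∸ 1) * (m * (m ∸ 1))
    zero-part : ∀ {x} → x ≤ a ⊔ d ⊔ (b ⊓ c) → x ≡ 0
    zero-part x≤α = n≤0⇒n≡0 (≤-trans x≤α (≤-reflexive α≡0))
    a≡0 : a ≡ 0
    a≡0 = zero-part (≤-trans (m≤m⊔n a d) (m≤m⊔n _ (b ⊓ c)))
    d≡0 : d ≡ 0
    d≡0 = zero-part (≤-trans (m≤n⊔m a d) (m≤m⊔n _ (b ⊓ c)))
    b⊓c≡0 : b ⊓ c ≡ 0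
    b⊓c≡0 = zero-part (m≤n⊔m (a ⊔ d) (b ⊓ c))
    0<b⊔c : 0 < b ⊔ c
    0<b⊔c = n≢0⇒n>0 λ p≡0 → F≢∅ (cong₂ _+_ (cong₂ _+_ (cong₂ _+_ a≡0
      (n≤0⇒n≡0 (≤-trans (m≤m⊔n b c) (≤-reflexive p≡0)))) (n≤0⇒n≡0 (≤-trans (m≤n⊔m b c) (≤-reflexive p≡0)))) d≡0)
    forb-pCol : IsForb m (2 + R) (pCol (b ⊔ c)) N
    forb-pCol = isForb-pCol 1≤R 0<b⊔c (fits (⊔-lub b≤μ c≤μ))
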